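{- For a finite tree $T$ on $n = |V(T)|$ vertices, let $$s_9(T) = \sqrt{n-1} - n + 1 - \lambda_1(T) + \alpha(T),$$ where $\lambda_1(T)$ is the largest eigenvalue of the adjacency matrix of $T$ and $\alpha(T)$ is the independence number of $T$. For each positive integer $b$, let $T(2,b)$ be the tree on $2b+1$ vertices with vertex set $\{u_1, \dots, u_b\} \cup \{v\} \cup \{w_1, \dots, w_b\}$ and edge set $\{u_1u_2, \dots, u_1u_b\} \cup \{u_1v, vw_1\} \cup \{w_1w_2, \dots, w_1w_b\}$. Then $$\lim_{b \to \infty} s_9(T(2,b)) = \infty.$$
   Context: Graphs are finite, simple and undirected; $V(G)$ and $E(G)$ denote the vertex and edge sets of $G$, and an edge $\{u,v\}$ is written $uv$. The adjacency matrix of $G$ is the square matrix $A$ indexed by $V(G)$ with $A(u,v) = 1$ if $u$ is adjacent to $v$ and $A(u,v) = 0$ otherwise. The independence number $\alpha(G)$ is the maximum size of a set of pairwise nonadjacent vertices of $G$. In the definition of $T(2,b)$ the $2b+1$ named vertices are pairwise distinct; $T(2,b)$ is the tree obtained by joining the centers of two copies of the star on $b$ vertices to a new vertex $v$. -}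

module Defs where

open import Algebra.Bundles.Raw using (RawMonoid)
import Algebra.Definitions.RawMonoid as RawMonoidDefinitions
open import Data.Bool.Base using (if_then_else_)
open import Data.Fin.Base using (Fin; zero; suc)
import Data.Fin.Properties as Fin
open import Data.Integer.Base using (+_)
open import Data.List.Base using (List; []; _∷_; _∷ʳ_; length)
open import Data.List.Relation.Unary.All using (All; []; _∷_)
open import Data.List.Relation.Unary.AllPairs using (_∷_)
open import Data.List.Relation.Unary.Linked using (Linked; [-]; _∷_)
open import Data.List.Relation.Unary.Unique.Propositional using (Unique)
open import Data.Fin.Subset using (Subset; _∈_; ∣_∣)
open import Data.Nat.Base as ℕ using (ℕ; zero; suc; NonZero)
import Data.Nat.Properties as ℕ
open import Data.Product.Base using (Σ-syntax; ∃-syntax; _×_; _,_; proj₁; proj₂)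
open import Data.Rational.Base as ℚ using (ℚ; 0ℚ; 1ℚ; ½)
import Data.Rational.Properties as ℚ
open import Data.Rational.Solver using (module +-*-Solver)
open import Data.Sum.Base using (_⊎_; inj₁; inj₂)
open import Function.Bundles using (_↔_; mk↔ₛ′; Inverse)
open import Function.Construct.Composition using (_↔-∘_)
open import Level using (0ℓ)
open import Relation.Binary.Construct.Closure.ReflexiveTransitive using (Star; ε; _◅_; _◅◅_)
import Relation.Binary.Construct.Closure.ReflexiveTransitive as Star
open import Relation.Binary.Construct.Closure.Symmetric using (SymClosure; fwd; bwd)
import Relation.Binary.Construct.Closure.Symmetric as SymClosure
open import Relation.Binary.Core using (Rel)
open import Relation.Binary.Definitions using (Decidable; Symmetric)
open import Relation.Binary.PropositionalEquality
  using (_≡_; _≢_; refl; sym; trans; cong; cong₂; subst)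
open import Relation.Nullary.Decidable using (yes; no; does; _⊎-dec_; map′)
open import Relation.Nullary.Negation using (¬_)

-- Reals are Cauchy sequences of rationals, each carrying a modulus.
-- Equality of reals is the equivalence _≈_, not _≡_.

IsCauchy : (ℕ → ℚ) → Set
IsCauchy x = ∀ δ → 0ℚ ℚ.< δ →
  ∃[ N ] ∀ m n → N ℕ.≤ m → N ℕ.≤ n → ℚ.∣ x m ℚ.- x n ∣ ℚ.≤ δ

record ℝ : Set where
  constructor mkℝ
  field
    seq    : ℕ → ℚ
    cauchy : IsCauchy seq

open ℝ public

private

  halves : ∀ δ → ½ ℚ.* δ ℚ.+ ½ ℚ.* δ ≡ δ
  halves = solve 1 (λ δ → con ½ :* δ :+ con ½ :* δ := δ) refl
    where open +-*-Solver

  0<½* : ∀ {δ} → 0ℚ ℚ.< δ → 0ℚ ℚ.< ½ ℚ.* δ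
  0<½* {δ} 0<δ = subst (ℚ._< ½ ℚ.* δ) (ℚ.*-zeroʳ ½) (ℚ.*-monoʳ-<-pos ½ 0<δ)

  EventuallyBounded : (ℕ → ℚ) → Set
  EventuallyBounded x =
    ∃[ K ] ℚ.Positive K × ∃[ N ] ∀ n → N ℕ.≤ n → ℚ.∣ x n ∣ ℚ.≤ K

  cauchy⇒bounded : ∀ {x} → IsCauchy x → EventuallyBounded x
  cauchy⇒bounded {x} cx with cx 1ℚ (ℚ.positive⁻¹ 1ℚ)
  ... | N , close = 1ℚ ℚ.+ ℚ.∣ x N ∣ , ℚ.positive 0<K , N , bound
    where
    open ℚ.≤-Reasoning
    0<K : 0ℚ ℚ.< 1ℚ ℚ.+ ℚ.∣ x N ∣
    0<K = ℚ.+-mono-<-≤ (ℚ.positive⁻¹ 1ℚ) (ℚ.0≤∣p∣ (x N))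
    split : ∀ a b → a ≡ (a ℚ.- b) ℚ.+ b
    split = solve 2 (λ a b → a := (a :- b) :+ b) refl
      where open +-*-Solver
    bound : ∀ n → N ℕ.≤ n → ℚ.∣ x n ∣ ℚ.≤ 1ℚ ℚ.+ ℚ.∣ x N ∣
    bound n N≤n = begin
      ℚ.∣ x n ∣                         ≡⟨ cong ℚ.∣_∣ (split (x n) (x N)) ⟩
      ℚ.∣ (x n ℚ.- x N) ℚ.+ x N ∣       ≤⟨ ℚ.∣p+q∣≤∣p∣+∣q∣ (x n ℚ.- x N) (x N) ⟩
      ℚ.∣ x n ℚ.- x N ∣ ℚ.+ ℚ.∣ x N ∣   ≤⟨ ℚ.+-monoˡ-≤ ℚ.∣ x N ∣ (close n N N≤n ℕ.≤-refl) ⟩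
      1ℚ ℚ.+ ℚ.∣ x N ∣                  ∎

  const-cauchy : ∀ q → IsCauchy (λ _ → q)
  const-cauchy q δ 0<δ = 0 , λ _ _ _ _ →
    ℚ.≤-trans (ℚ.≤-reflexive (cong ℚ.∣_∣ (ℚ.+-inverseʳ q))) (ℚ.<⇒≤ 0<δ)

  +-cauchy : ∀ {x y} → IsCauchy x → IsCauchy y → IsCauchy (λ n → x n ℚ.+ y n)
  +-cauchy {x} {y} cx cy δ 0<δ with cx (½ ℚ.* δ) (0<½* 0<δ) | cy (½ ℚ.* δ) (0<½* 0<δ)
  ... | M , closeˣ | N , closeʸ = M ℕ.⊔ N , λ m n ≤m ≤n → begin
      ℚ.∣ (x m ℚ.+ y m) ℚ.- (x n ℚ.+ y n) ∣
        ≡⟨ cong ℚ.∣_∣ (regroup (x m) (y m) (x n) (y n)) ⟩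
      ℚ.∣ (x m ℚ.- x n) ℚ.+ (y m ℚ.- y n) ∣
        ≤⟨ ℚ.∣p+q∣≤∣p∣+∣q∣ (x m ℚ.- x n) (y m ℚ.- y n) ⟩
      ℚ.∣ x m ℚ.- x n ∣ ℚ.+ ℚ.∣ y m ℚ.- y n ∣
        ≤⟨ ℚ.+-mono-≤
             (closeˣ m n (ℕ.m⊔n≤o⇒m≤o M N ≤m) (ℕ.m⊔n≤o⇒m≤o M N ≤n))
             (closeʸ m n (ℕ.m⊔n≤o⇒n≤o M N ≤m) (ℕ.m⊔n≤o⇒n≤o M N ≤n)) ⟩
      ½ ℚ.* δ ℚ.+ ½ ℚ.* δ
        ≡⟨ halves δ ⟩
      δ ∎
    where
    open ℚ.≤-Reasoning
    regroup : ∀ a b c d → (a ℚ.+ b) ℚ.- (c ℚ.+ d) ≡ (a ℚ.- c) ℚ.+ (b ℚ.- d)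
    regroup = solve 4 (λ a b c d → (a :+ b) :- (c :+ d) := (a :- c) :+ (b :- d)) refl
      where open +-*-Solver

  neg-cauchy : ∀ {x} → IsCauchy x → IsCauchy (λ n → ℚ.- x n)
  neg-cauchy {x} cx δ 0<δ with cx δ 0<δ
  ... | N , close = N , λ m n ≤m ≤n →
      subst (ℚ._≤ δ)
        (trans (sym (ℚ.∣-p∣≡∣p∣ (x m ℚ.- x n))) (cong ℚ.∣_∣ (distrib (x m) (x n))))
        (close m n ≤m ≤n)
    where
    distrib : ∀ a b → ℚ.- (a ℚ.- b) ≡ (ℚ.- a) ℚ.- (ℚ.- b)
    distrib = solve 2 (λ a b → :- (a :- b) := (:- a) :- (:- b)) refl
      where open +-*-Solver

  module _ (K : ℚ) {{pos : ℚ.Positive K}} where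
    private instance
      K≢0 : ℚ.NonZero K
      K≢0 = ℚ.pos⇒nonZero K

    _÷K : ℚ → ℚ
    δ ÷K = ℚ.1/ K ℚ.* δ

    0<÷ : ∀ {δ} → 0ℚ ℚ.< δ → 0ℚ ℚ.< δ ÷K
    0<÷ {δ} 0<δ = subst (ℚ._< δ ÷K) (ℚ.*-zeroʳ (ℚ.1/ K))
      (ℚ.*-monoʳ-<-pos (ℚ.1/ K) {{ℚ.1/pos⇒pos K}} 0<δ)

    ∣*∣≤ : ∀ {a d} δ → ℚ.∣ a ∣ ℚ.≤ K → ℚ.∣ d ∣ ℚ.≤ δ ÷K → ℚ.∣ a ℚ.* d ∣ ℚ.≤ δ
    ∣*∣≤ {a} {d} δ a≤ d≤ = begin
      ℚ.∣ a ℚ.* d ∣            ≡⟨ ℚ.∣p*q∣≡∣p∣*∣q∣ a d ⟩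
      ℚ.∣ a ∣ ℚ.* ℚ.∣ d ∣      ≤⟨ ℚ.*-monoʳ-≤-nonNeg ℚ.∣ d ∣ {{ℚ.∣-∣-nonNeg d}} a≤ ⟩
      K ℚ.* ℚ.∣ d ∣            ≤⟨ ℚ.*-monoˡ-≤-nonNeg K {{ℚ.pos⇒nonNeg K}} d≤ ⟩
      K ℚ.* (ℚ.1/ K ℚ.* δ)     ≡⟨ ℚ.*-assoc K (ℚ.1/ K) δ ⟨
      (K ℚ.* ℚ.1/ K) ℚ.* δ     ≡⟨ cong (ℚ._* δ) (ℚ.*-inverseʳ K) ⟩
      1ℚ ℚ.* δ                 ≡⟨ ℚ.*-identityˡ δ ⟩
      δ                        ∎
      where open ℚ.≤-Reasoning

  factor : ∀ a b c → a ℚ.* b ℚ.- a ℚ.* c ≡ a ℚ.* (b ℚ.- c)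
  factor a b c = trans (cong (a ℚ.* b ℚ.+_) (ℚ.neg-distribʳ-* a c))
    (sym (ℚ.*-distribˡ-+ a b (ℚ.- c)))

  regroup-* : ∀ a b c d →
    a ℚ.* b ℚ.- c ℚ.* d ≡ a ℚ.* (b ℚ.- d) ℚ.+ d ℚ.* (a ℚ.- c)
  regroup-* a b c d = trans (telescope (a ℚ.* b) (a ℚ.* d) (c ℚ.* d))
    (cong₂ ℚ._+_ (factor a b d)
      (trans (cong₂ ℚ._-_ (ℚ.*-comm a d) (ℚ.*-comm c d)) (factor d a c)))
    where
    telescope : ∀ p q r → p ℚ.- r ≡ (p ℚ.- q) ℚ.+ (q ℚ.- r)
    telescope = solve 3 (λ p q r → p :- r := (p :- q) :+ (q :- r)) refl
      where open +-*-Solver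

  *-close : ∀ K L {{_ : ℚ.Positive K}} {{_ : ℚ.Positive L}} a b c d δ →
    ℚ.∣ a ∣ ℚ.≤ K → ℚ.∣ d ∣ ℚ.≤ L →
    ℚ.∣ b ℚ.- d ∣ ℚ.≤ _÷K K (½ ℚ.* δ) → ℚ.∣ a ℚ.- c ∣ ℚ.≤ _÷K L (½ ℚ.* δ) →
    ℚ.∣ a ℚ.* b ℚ.- c ℚ.* d ∣ ℚ.≤ δ
  *-close K L a b c d δ a≤ d≤ b-d≤ a-c≤ = begin
    ℚ.∣ a ℚ.* b ℚ.- c ℚ.* d ∣
      ≡⟨ cong ℚ.∣_∣ (regroup-* a b c d) ⟩
    ℚ.∣ a ℚ.* (b ℚ.- d) ℚ.+ d ℚ.* (a ℚ.- c) ∣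
      ≤⟨ ℚ.∣p+q∣≤∣p∣+∣q∣ (a ℚ.* (b ℚ.- d)) (d ℚ.* (a ℚ.- c)) ⟩
    ℚ.∣ a ℚ.* (b ℚ.- d) ∣ ℚ.+ ℚ.∣ d ℚ.* (a ℚ.- c) ∣
      ≤⟨ ℚ.+-mono-≤
           (∣*∣≤ K {a} {b ℚ.- d} (½ ℚ.* δ) a≤ b-d≤)
           (∣*∣≤ L {d} {a ℚ.- c} (½ ℚ.* δ) d≤ a-c≤) ⟩
    ½ ℚ.* δ ℚ.+ ½ ℚ.* δ
      ≡⟨ halves δ ⟩
    δ ∎
    where open ℚ.≤-Reasoning

  *-cauchy : ∀ {x y} → IsCauchy x → IsCauchy y → IsCauchy (λ n → x n ℚ.* y n)
  *-cauchy {x} {y} cx cy δ 0<δ = from (cauchy⇒bounded {x} cx) (cauchy⇒bounded {y} cy)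
    where
    from : EventuallyBounded x → EventuallyBounded y →
      ∃[ N ] ∀ m n → N ℕ.≤ m → N ℕ.≤ n → ℚ.∣ x m ℚ.* y m ℚ.- x n ℚ.* y n ∣ ℚ.≤ δ
    from (K , K>0 , A , boundˣ) (L , L>0 , B , boundʸ) =
      (A ℕ.⊔ B) ℕ.⊔ (M ℕ.⊔ N) , λ m n ≤m ≤n →
        *-close K L (x m) (y m) (x n) (y n) δ
          (boundˣ m (ℕ.m⊔n≤o⇒m≤o A B (ℕ.m⊔n≤o⇒m≤o (A ℕ.⊔ B) (M ℕ.⊔ N) ≤m)))
          (boundʸ n (ℕ.m⊔n≤o⇒n≤o A B (ℕ.m⊔n≤o⇒m≤o (A ℕ.⊔ B) (M ℕ.⊔ N) ≤n)))
          (proj₂ closeʸ m n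
            (ℕ.m⊔n≤o⇒n≤o M N (ℕ.m⊔n≤o⇒n≤o (A ℕ.⊔ B) (M ℕ.⊔ N) ≤m))
            (ℕ.m⊔n≤o⇒n≤o M N (ℕ.m⊔n≤o⇒n≤o (A ℕ.⊔ B) (M ℕ.⊔ N) ≤n)))
          (proj₂ closeˣ m n
            (ℕ.m⊔n≤o⇒m≤o M N (ℕ.m⊔n≤o⇒n≤o (A ℕ.⊔ B) (M ℕ.⊔ N) ≤m))
            (ℕ.m⊔n≤o⇒m≤o M N (ℕ.m⊔n≤o⇒n≤o (A ℕ.⊔ B) (M ℕ.⊔ N) ≤n)))
      where
      instance
        K-pos : ℚ.Positive K
        K-pos = K>0
        L-pos : ℚ.Positive L
        L-pos = L>0
      closeˣ = cx (_÷K L (½ ℚ.* δ)) (0<÷ L (0<½* 0<δ))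
      closeʸ = cy (_÷K K (½ ℚ.* δ)) (0<÷ K (0<½* 0<δ))
      M = proj₁ closeˣ
      N = proj₁ closeʸ

infixl 6 _+_ _-_
infixl 7 _*_
infix  8 -_
infix  4 _≈_ _<_ _≤_

fromℚ : ℚ → ℝ
fromℚ q = mkℝ (λ _ → q) (const-cauchy q)

fromℕ : ℕ → ℝ
fromℕ n = fromℚ (+ n ℚ./ 1)

0ℝ 1ℝ : ℝ
0ℝ = fromℚ 0ℚ
1ℝ = fromℚ 1ℚ

_+_ _*_ : ℝ → ℝ → ℝ
x + y = mkℝ (λ n → seq x n ℚ.+ seq y n)
  (+-cauchy {seq x} {seq y} (cauchy x) (cauchy y))
x * y = mkℝ (λ n → seq x n ℚ.* seq y n)
  (*-cauchy {seq x} {seq y} (cauchy x) (cauchy y))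

-_ : ℝ → ℝ
- x = mkℝ (λ n → ℚ.- seq x n) (neg-cauchy {seq x} (cauchy x))

_-_ : ℝ → ℝ → ℝ
x - y = x + (- y)

_≈_ _<_ _≤_ : Rel ℝ 0ℓ
x ≈ y = ∀ δ → 0ℚ ℚ.< δ → ∃[ N ] ∀ n → N ℕ.≤ n → ℚ.∣ seq x n ℚ.- seq y n ∣ ℚ.≤ δ
x < y = ∃[ δ ] 0ℚ ℚ.< δ × ∃[ N ] ∀ n → N ℕ.≤ n → seq x n ℚ.+ δ ℚ.≤ seq y n
x ≤ y = ¬ (y < x)

+-0-rawMonoid : RawMonoid 0ℓ 0ℓ
+-0-rawMonoid = record { Carrier = ℝ ; _≈_ = _≈_ ; _∙_ = _+_ ; ε = 0ℝ }

open RawMonoidDefinitions +-0-rawMonoid public using (sum)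

IsSqrt : ℝ → ℝ → Set
IsSqrt x r = 0ℝ ≤ r × r * r ≈ x

record Graph : Set₁ where
  field
    Vertex      : Set
    order       : ℕ
    enumeration : Fin order ↔ Vertex
    Adj         : Rel Vertex 0ℓ
    adj?        : Decidable Adj
    adj-sym     : Symmetric Adj
    adj-irrefl  : ∀ {x} → ¬ Adj x x

  vertex : Fin order → Vertex
  vertex = Inverse.to enumeration

module _ (G : Graph) where
  open Graph G

  -- The cycle x , xs₁ , … , xsₖ , x has k + 1 ≥ 3 distinct vertices.
  IsCycle : Vertex → List Vertex → Set
  IsCycle x xs = 2 ℕ.≤ length xs × Unique (x ∷ xs) × Linked Adj (x ∷ xs ∷ʳ x)

  record IsTree : Set where
    field
      root      : Vertex
      connected : ∀ x y → Star Adj x y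
      acyclic   : ∀ x xs → ¬ IsCycle x xs

  adjacencyMatrix : Vertex → Vertex → ℝ
  adjacencyMatrix x y = if does (adj? x y) then 1ℝ else 0ℝ

  IsEigenvalue : (Vertex → Vertex → ℝ) → ℝ → Set
  IsEigenvalue M μ = Σ[ f ∈ (Vertex → ℝ) ]
      ¬ (∀ x → f x ≈ 0ℝ)
    × (∀ x → sum (λ i → M x (vertex i) * f (vertex i)) ≈ μ * f x)

  -- All eigenvalues of a real symmetric matrix are real, so real ones suffice.
  IsLargestEigenvalue : (Vertex → Vertex → ℝ) → ℝ → Set
  IsLargestEigenvalue M μ = IsEigenvalue M μ × (∀ ν → IsEigenvalue M ν → ν ≤ μ)

  IsIndependent : Subset order → Set
  IsIndependent S = ∀ i j → i ∈ S → j ∈ S → ¬ Adj (vertex i) (vertex j)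

  IsIndependenceNumber : ℕ → Set
  IsIndependenceNumber a =
      (∃[ S ] IsIndependent S × ∣ S ∣ ≡ a)
    × (∀ S → IsIndependent S → ∣ S ∣ ℕ.≤ a)

record Tree : Set₁ where
  field
    graph  : Graph
    isTree : IsTree graph
  open Graph graph public

-- s₉ as a single-valued (up to _≈_) relation: `IsS₉ T s` says that s₉(T) = s.
IsS₉ : Tree → ℝ → Set
IsS₉ T s = ∃[ r ] ∃[ μ ] ∃[ a ]
    IsSqrt (fromℕ order - 1ℝ) r
  × IsLargestEigenvalue graph (adjacencyMatrix graph) μ
  × IsIndependenceNumber graph a
  × s ≈ r - fromℕ order + 1ℝ - μ + fromℕ a
  where open Tree T

data T2Vertex (b : ℕ) : Set where
  u : Fin b → T2Vertex b
  v : T2Vertex b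
  w : Fin b → T2Vertex b

-- u zero and w zero are the centres u₁ and w₁.
data T2Edge {k : ℕ} : Rel (T2Vertex (suc k)) 0ℓ where
  u₁uᵢ : ∀ {i} → T2Edge (u zero) (u (suc i))
  u₁v  : T2Edge (u zero) v
  vw₁  : T2Edge v (w zero)
  w₁wᵢ : ∀ {i} → T2Edge (w zero) (w (suc i))

private

  T2Adj : ∀ {k} → Rel (T2Vertex (suc k)) 0ℓ
  T2Adj = SymClosure T2Edge

  T2-enumeration : ∀ b → Fin (b ℕ.+ (1 ℕ.+ b)) ↔ T2Vertex b
  T2-enumeration b = sumToVertex ↔-∘ Fin.+↔⊎ {b} {1 ℕ.+ b}
    where
    to : Fin b ⊎ Fin (1 ℕ.+ b) → T2Vertex b
    to (inj₁ i)       = u i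
    to (inj₂ zero)    = v
    to (inj₂ (suc i)) = w i
    from : T2Vertex b → Fin b ⊎ Fin (1 ℕ.+ b)
    from (u i) = inj₁ i
    from v     = inj₂ zero
    from (w i) = inj₂ (suc i)
    sumToVertex : (Fin b ⊎ Fin (1 ℕ.+ b)) ↔ T2Vertex b
    sumToVertex = mk↔ₛ′ to from
      (λ { (u i) → refl ; v → refl ; (w i) → refl })
      (λ { (inj₁ i) → refl ; (inj₂ zero) → refl ; (inj₂ (suc i)) → refl })

  T2Edge? : ∀ {k} → Decidable (T2Edge {k})
  T2Edge? (u zero)    (u zero)    = no λ ()
  T2Edge? (u zero)    (u (suc i)) = yes u₁uᵢ
  T2Edge? (u zero)    v           = yes u₁v
  T2Edge? (u zero)    (w i)       = no λ ()
  T2Edge? (u (suc i)) y           = no λ ()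
  T2Edge? v           (u i)       = no λ ()
  T2Edge? v           v           = no λ ()
  T2Edge? v           (w zero)    = yes vw₁
  T2Edge? v           (w (suc i)) = no λ ()
  T2Edge? (w zero)    (u i)       = no λ ()
  T2Edge? (w zero)    v           = no λ ()
  T2Edge? (w zero)    (w zero)    = no λ ()
  T2Edge? (w zero)    (w (suc i)) = yes w₁wᵢ
  T2Edge? (w (suc i)) y           = no λ ()

  T2Adj? : ∀ {k} → Decidable (T2Adj {k})
  T2Adj? x y = map′
    (λ { (inj₁ e) → fwd e ; (inj₂ e) → bwd e })
    (λ { (fwd e) → inj₁ e ; (bwd e) → inj₂ e })
    (T2Edge? x y ⊎-dec T2Edge? y x)

-- T2Graph k is T(2,k+1).
T2Graph : ℕ → Graph
T2Graph k = record
  { Vertex      = T2Vertex (suc k)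
  ; order       = suc k ℕ.+ (1 ℕ.+ suc k)
  ; enumeration = T2-enumeration (suc k)
  ; Adj         = SymClosure T2Edge
  ; adj?        = T2Adj?
  ; adj-sym     = SymClosure.symmetric T2Edge
  ; adj-irrefl  = λ { (fwd ()) ; (bwd ()) }
  }

private

  toV : ∀ {k} (x : T2Vertex (suc k)) → Star T2Adj x v
  toV (u zero)    = fwd u₁v ◅ ε
  toV (u (suc i)) = bwd u₁uᵢ ◅ fwd u₁v ◅ ε
  toV v           = ε
  toV (w zero)    = bwd vw₁ ◅ ε
  toV (w (suc i)) = bwd w₁wᵢ ◅ bwd vw₁ ◅ ε

  T2-connected : ∀ {k} (x y : T2Vertex (suc k)) → Star T2Adj x y
  T2-connected x y = toV x ◅◅ Star.reverse (SymClosure.symmetric T2Edge) (toV y)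

  module _ {V : Set} {R : Rel V 0ℓ} where

    Leaf : V → Set
    Leaf l = ∀ {a c} → R a l → R l c → a ≡ c

    lastStep : ∀ {x} z zs → Linked R (z ∷ zs ∷ʳ x) →
      ∃[ q ] (∀ {y} → All (y ≢_) (z ∷ zs) → y ≢ q) × R q x
    lastStep z []       (zRx ∷ [-]) = z , (λ { (y≢z ∷ []) → y≢z }) , zRx
    lastStep z (t ∷ zs) (_ ∷ links) with lastStep t zs links
    ... | q , ≢q , qRx = q , (λ { (_ ∷ y≢) → ≢q y≢ }) , qRx

    no-leaf-first : ∀ {x y z zs} → All (y ≢_) (z ∷ zs) →
      Linked R (x ∷ y ∷ z ∷ zs ∷ʳ x) → ¬ Leaf x
    no-leaf-first {z = z} {zs} y≢ (xRy ∷ _ ∷ links) leaf with lastStep z zs links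
    ... | q , ≢q , qRx = ≢q y≢ (sym (leaf qRx xRy))

    no-leaf-inside : ∀ {x y z} zs → x ≢ y → All (y ≢_) zs →
      R y z → Linked R (z ∷ zs ∷ʳ x) → ¬ Leaf z
    no-leaf-inside []      x≢y _         yRz (zRx ∷ _) leaf = x≢y (sym (leaf yRz zRx))
    no-leaf-inside (_ ∷ _) _   (y≢t ∷ _) yRz (zRt ∷ _) leaf = y≢t (leaf yRz zRt)

  leafᵘ : ∀ {k} {i : Fin k} → Leaf {R = T2Adj} (u (suc i))
  leafᵘ (fwd u₁uᵢ) (bwd u₁uᵢ) = refl

  leafʷ : ∀ {k} {i : Fin k} → Leaf {R = T2Adj} (w (suc i))
  leafʷ (fwd w₁wᵢ) (bwd w₁wᵢ) = refl

  T2-acyclic : ∀ {k} (x : T2Vertex (suc k)) xs → ¬ IsCycle (T2Graph k) x xs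
  T2-acyclic x []       (()       , _)
  T2-acyclic x (_ ∷ []) (ℕ.s≤s () , _)
  T2-acyclic x (y ∷ z ∷ zs)
    (_ , (x≢y ∷ x≢z ∷ _) ∷ (y≢z ∷ y≢zs) ∷ z≢zs ∷ _ , links@(x~y ∷ y~z ∷ zLinks)) =
    go zs x≢y x≢z (y≢z ∷ y≢zs) z≢zs x~y y~z links zLinks
    where
    u₁-v-w₁ : ∀ {k} zs → All (v ≢_) zs → All (w zero ≢_) zs →
      ¬ Linked (T2Adj {k}) (w zero ∷ zs ∷ʳ u zero)
    u₁-v-w₁ []       _         _         (fwd () ∷ _)
    u₁-v-w₁ []       _         _         (bwd () ∷ _)
    u₁-v-w₁ (_ ∷ _)  (v≢v ∷ _) _         (bwd vw₁ ∷ _) = v≢v refl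
    u₁-v-w₁ (_ ∷ zs) _         (_ ∷ w≢) (fwd w₁wᵢ ∷ links) =
      no-leaf-inside zs (λ ()) w≢ (fwd w₁wᵢ) links leafʷ

    w₁-v-u₁ : ∀ {k} zs → All (v ≢_) zs → All (u zero ≢_) zs →
      ¬ Linked (T2Adj {k}) (u zero ∷ zs ∷ʳ w zero)
    w₁-v-u₁ []       _         _         (fwd () ∷ _)
    w₁-v-u₁ []       _         _         (bwd () ∷ _)
    w₁-v-u₁ (_ ∷ _)  (v≢v ∷ _) _         (fwd u₁v ∷ _) = v≢v refl
    w₁-v-u₁ (_ ∷ zs) _         (_ ∷ u≢) (fwd u₁uᵢ ∷ links) =
      no-leaf-inside zs (λ ()) u≢ (fwd u₁uᵢ) links leafᵘ

    go : ∀ {k} {x y z : T2Vertex (suc k)} zs → x ≢ y → x ≢ z →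
      All (y ≢_) (z ∷ zs) → All (z ≢_) zs → T2Adj x y → T2Adj y z →
      Linked T2Adj (x ∷ y ∷ z ∷ zs ∷ʳ x) → ¬ Linked T2Adj (z ∷ zs ∷ʳ x)
    go _  _   _   y≢       _  (bwd u₁uᵢ) _            ls _   = no-leaf-first y≢ ls leafᵘ
    go _  _   _   y≢       _  (bwd w₁wᵢ) _            ls _   = no-leaf-first y≢ ls leafʷ
    go _  _   x≢z _        _  (fwd u₁uᵢ) (bwd u₁uᵢ)   _  _   = x≢z refl
    go _  _   x≢z _        _  (fwd w₁wᵢ) (bwd w₁wᵢ)   _  _   = x≢z refl
    go _  _   x≢z _        _  (fwd u₁v)  (bwd u₁v)    _  _   = x≢z refl
    go _  _   x≢z _        _  (bwd u₁v)  (fwd u₁v)    _  _   = x≢z refl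
    go _  _   x≢z _        _  (fwd vw₁)  (bwd vw₁)    _  _   = x≢z refl
    go _  _   x≢z _        _  (bwd vw₁)  (fwd vw₁)    _  _   = x≢z refl
    go zs x≢y _   (_ ∷ y≢) _  (bwd u₁v)  e@(fwd u₁uᵢ) _  zls =
      no-leaf-inside zs x≢y y≢ e zls leafᵘ
    go zs x≢y _   (_ ∷ y≢) _  (fwd vw₁)  e@(fwd w₁wᵢ) _  zls =
      no-leaf-inside zs x≢y y≢ e zls leafʷ
    go zs _   _   (_ ∷ y≢) z≢ (fwd u₁v)  (fwd vw₁)    _  zls = u₁-v-w₁ zs y≢ z≢ zls
    go zs _   _   (_ ∷ y≢) z≢ (bwd vw₁)  (bwd u₁v)    _  zls = w₁-v-u₁ zs y≢ z≢ zls

T2 : (b : ℕ) .{{_ : NonZero b}} → Tree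
T2 (suc k) = record
  { graph  = T2Graph k
  ; isTree = record { root = v ; connected = T2-connected ; acyclic = T2-acyclic }
  }

TendsTo∞ : ((b : ℕ) .{{_ : NonZero b}} → ℝ) → Set
TendsTo∞ s = ∀ M → ∃[ B ] ∀ b .{{_ : NonZero b}} → B ℕ.≤ b → M < s b

{-# OPTIONS --safe #-}

-- An eigenvector of T(2,b) for an eigenvalue ν > 0 is determined by its values at u₁, w₁ and v, and the
-- equations at these three vertices force ν² ≤ b + 1. Taking 1 on the leaves, √(b+1) on the centres and
-- 2 at v shows λ₁ = √(b+1). The leaves together with v are independent, so α ≥ 2b − 1 and
-- s₉ ≥ √(2b) − √(b+1) − 1. For an integer L, √(b+1) + L ≤ √(2b) as soon as b ≥ 6L² + 3.

module Submission where

import Defs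
open import Defs hiding (_+_; _*_; -_; _-_; sum)
open import Algebra.Bundles using (CommutativeRing)
import Algebra.Consequences.Setoid
import Algebra.Properties.Semiring.Sum as Sum
import Algebra.Solver.Ring
import Algebra.Solver.Ring.AlmostCommutativeRing as ACR
open import Data.Fin.Base using (Fin; zero; suc; _↑ˡ_; _↑ʳ_)
import Data.Fin.Properties as Fin
open import Data.Fin.Subset using (Subset; inside; outside; ⊤; ⊥; ∣_∣; _∈_)
open import Data.Fin.Subset.Properties using (anySubset?; _∈?_; ∣p∣≤n; ∣⊥∣≡0; ∣⊤∣≡n; ∉⊥)
open import Data.Integer.Base as ℤ using (+_)
import Data.Integer.Properties as ℤ
open import Data.Maybe.Base as Maybe using (Maybe)
open import Data.Nat.Base as ℕ using (ℕ; NonZero; zero; suc)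
import Data.Nat.Properties as ℕ
open import Data.Product.Base using (∃-syntax; _×_; _,_; proj₁; proj₂)
open import Data.Rational.Base as ℚ using (ℚ; 0ℚ; 1ℚ; ½)
import Data.Rational.Properties as ℚ
open import Data.Rational.Solver using (module +-*-Solver)
open import Data.Rational.Unnormalised.Base as ℚᵘ using (mkℚᵘ)
import Data.Rational.Unnormalised.Properties as ℚᵘ
open import Data.Sum.Base using (inj₁; inj₂)
open import Data.Vec.Base using (lookup; _++_; []; _∷_)
open import Data.Vec.Properties using ([]=⇒lookup; lookup-++ʳ)
open import Function.Base using (_∘_)
open import Function.Bundles using (Inverse)
open import Level using (0ℓ)
open import Relation.Binary.Bundles using (Setoid)
open import Relation.Binary.Construct.Closure.Symmetric using (fwd; bwd)
open import Relation.Binary.PropositionalEquality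
  using (_≡_; _≢_; refl; sym; trans; cong; cong₂; subst; subst₂; module ≡-Reasoning)
import Relation.Binary.Reasoning.Setoid as SetoidReasoning
open import Relation.Nullary.Decidable using (yes; no; dec⇒maybe; _→-dec_; _×-dec_; ¬?)
open import Relation.Nullary.Negation using (¬_; contradiction)
open import Relation.Unary using (Decidable)

-- Rationals

-- The order on the reals is undecidable and `≤` is only the negation of `<`, so a fact such as x ≥
-- 0 yields rational bounds only after a tolerance has been chosen. This shapes the argument.
-- Comparisons are moved to the sign of a difference. A strict inequality is proved by writing that
-- difference as one positive term plus terms that are not negative. Division becomes the
-- cancellation of a factor with a positive rational gap. The bound on eigenvalues is proved by
-- contradiction: a strict excess over √(b + 1) supplies exactly the positive factors that can be
-- cancelled, and the eigenvector then vanishes. Since s₉ is given as a relation, a value must also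
-- be exhibited for every b, which calls for an actual square root and an actual independence
-- number.

p≤∣p∣ : ∀ p → p ℚ.≤ ℚ.∣ p ∣
p≤∣p∣ p with ℚ.≤-total 0ℚ p
... | inj₁ 0≤p = ℚ.≤-reflexive (sym (ℚ.0≤p⇒∣p∣≡p 0≤p))
... | inj₂ p≤0 = ℚ.≤-trans p≤0 (ℚ.0≤∣p∣ p)

∣p∣≤q : ∀ {p q} → p ℚ.≤ q → ℚ.- p ℚ.≤ q → ℚ.∣ p ∣ ℚ.≤ q
∣p∣≤q {p} {q} p≤q -p≤q with ℚ.∣p∣≡p∨∣p∣≡-p p
... | inj₁ eq = subst (ℚ._≤ q) (sym eq) p≤q
... | inj₂ eq = subst (ℚ._≤ q) (sym eq) -p≤q

p-q≤r⇒p≤q+r : ∀ p q {r} → p ℚ.- q ℚ.≤ r → p ℚ.≤ q ℚ.+ r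
p-q≤r⇒p≤q+r p q {r} le = begin
  p                    ≡⟨ solve 2 (λ p q → p := q :+ (p :- q)) refl p q ⟩
  q ℚ.+ (p ℚ.- q)      ≤⟨ ℚ.+-monoʳ-≤ q le ⟩
  q ℚ.+ r              ∎
  where open ℚ.≤-Reasoning
        open +-*-Solver

p≤q+r⇒p-q≤r : ∀ p q {r} → p ℚ.≤ q ℚ.+ r → p ℚ.- q ℚ.≤ r
p≤q+r⇒p-q≤r p q {r} le = begin
  p ℚ.- q              ≤⟨ ℚ.+-monoˡ-≤ (ℚ.- q) le ⟩
  (q ℚ.+ r) ℚ.- q      ≡⟨ solve 2 (λ q r → (q :+ r) :- q := r) refl q r ⟩
  r                    ∎
  where open ℚ.≤-Reasoning
        open +-*-Solver

neg-minus : ∀ p q → ℚ.- (p ℚ.- q) ≡ q ℚ.- p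
neg-minus = solve 2 (λ p q → :- (p :- q) := q :- p) refl
  where open +-*-Solver

close⇒≤ : ∀ p q {r} → ℚ.∣ p ℚ.- q ∣ ℚ.≤ r → p ℚ.≤ q ℚ.+ r
close⇒≤ p q close = p-q≤r⇒p≤q+r p q (ℚ.≤-trans (p≤∣p∣ (p ℚ.- q)) close)

close⇒≥ : ∀ p q {r} → ℚ.∣ p ℚ.- q ∣ ℚ.≤ r → q ℚ.≤ p ℚ.+ r
close⇒≥ p q {r} close = close⇒≤ q p (subst (ℚ._≤ r)
  (trans (sym (ℚ.∣-p∣≡∣p∣ (p ℚ.- q))) (cong ℚ.∣_∣ (neg-minus p q))) close)

≤⇒close : ∀ p q {r} → p ℚ.≤ q ℚ.+ r → q ℚ.≤ p ℚ.+ r → ℚ.∣ p ℚ.- q ∣ ℚ.≤ r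
≤⇒close p q {r} p≤ q≤ = ∣p∣≤q (p≤q+r⇒p-q≤r p q p≤)
  (subst (ℚ._≤ r) (sym (neg-minus p q)) (p≤q+r⇒p-q≤r q p q≤))

*-mono-≤-nonNeg : ∀ {p q r s} → 0ℚ ℚ.≤ q → 0ℚ ℚ.≤ r →
  p ℚ.≤ q → r ℚ.≤ s → p ℚ.* r ℚ.≤ q ℚ.* s
*-mono-≤-nonNeg {p} {q} {r} {s} 0≤q 0≤r p≤q r≤s = ℚ.≤-trans
  (ℚ.*-monoʳ-≤-nonNeg r {{ℚ.nonNegative 0≤r}} p≤q)
  (ℚ.*-monoˡ-≤-nonNeg q {{ℚ.nonNegative 0≤q}} r≤s)

0≤* : ∀ {p q} → 0ℚ ℚ.≤ p → 0ℚ ℚ.≤ q → 0ℚ ℚ.≤ p ℚ.* q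
0≤* {p} {q} 0≤p 0≤q = ℚ.nonNegative⁻¹ (p ℚ.* q)
  {{ℚ.nonNeg*nonNeg⇒nonNeg p {{ℚ.nonNegative 0≤p}} q {{ℚ.nonNegative 0≤q}}}}

-- Were q ≤ p, then p would be non-negative too and squaring would preserve the order.
p²<q²⇒p<q : ∀ {p q} → 0ℚ ℚ.≤ q → p ℚ.* p ℚ.< q ℚ.* q → p ℚ.< q
p²<q²⇒p<q {p} {q} 0≤q p²<q² = ℚ.≰⇒> λ q≤p → ℚ.<-irrefl refl
  (ℚ.<-≤-trans p²<q² (*-mono-≤-nonNeg (ℚ.≤-trans 0≤q q≤p) 0≤q q≤p q≤p))

0<* : ∀ {p q} → 0ℚ ℚ.< p → 0ℚ ℚ.< q → 0ℚ ℚ.< p ℚ.* q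
0<* {p} {q} 0<p 0<q = ℚ.positive⁻¹ (p ℚ.* q)
  {{ℚ.pos*pos⇒pos p {{ℚ.positive 0<p}} q {{ℚ.positive 0<q}}}}

0<½* : ∀ {p} → 0ℚ ℚ.< p → 0ℚ ℚ.< ½ ℚ.* p
0<½* = 0<* (ℚ.positive⁻¹ ½)

halves : ∀ p → ½ ℚ.* p ℚ.+ ½ ℚ.* p ≡ p
halves = solve 1 (λ p → con ½ :* p :+ con ½ :* p := p) refl
  where open +-*-Solver

-- Natural numbers among the rationals, the Archimedean property and integer square roots

ι : ℕ → ℚ
ι n = + n ℚ./ 1

-- `_/_` reduces to lowest terms and does not compute on a variable; among unnormalised fractions
-- n/1 is literal, so the laws of `ι` are proved there and carried back.
toℚᵘ-ι : ∀ n → ℚ.toℚᵘ (ι n) ℚᵘ.≃ mkℚᵘ (+ n) 0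
toℚᵘ-ι n = ℚ.toℚᵘ-fromℚᵘ (mkℚᵘ (+ n) 0)

ι-+ : ∀ m n → ι (m ℕ.+ n) ≡ ι m ℚ.+ ι n
ι-+ m n = ℚ.toℚᵘ-injective (begin
  ℚ.toℚᵘ (ι (m ℕ.+ n))                  ≈⟨ toℚᵘ-ι (m ℕ.+ n) ⟩
  mkℚᵘ (+ (m ℕ.+ n)) 0                  ≈⟨ ℚᵘ.*≡* (cong (ℤ._* + 1) (sym (cong₂ ℤ._+_ (ℤ.*-identityʳ (+ m)) (ℤ.*-identityʳ (+ n))))) ⟩
  mkℚᵘ (+ m) 0 ℚᵘ.+ mkℚᵘ (+ n) 0        ≈⟨ ℚᵘ.+-cong (toℚᵘ-ι m) (toℚᵘ-ι n) ⟨
  ℚ.toℚᵘ (ι m) ℚᵘ.+ ℚ.toℚᵘ (ι n)        ≈⟨ ℚ.toℚᵘ-homo-+ (ι m) (ι n) ⟨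
  ℚ.toℚᵘ (ι m ℚ.+ ι n)                  ∎)
  where open ℚᵘ.≃-Reasoning

ι-* : ∀ m n → ι (m ℕ.* n) ≡ ι m ℚ.* ι n
ι-* m n = ℚ.toℚᵘ-injective (begin
  ℚ.toℚᵘ (ι (m ℕ.* n))                  ≈⟨ toℚᵘ-ι (m ℕ.* n) ⟩
  mkℚᵘ (+ (m ℕ.* n)) 0                  ≈⟨ ℚᵘ.*≡* (cong (ℤ._* + 1) (ℤ.pos-* m n)) ⟩
  mkℚᵘ (+ m) 0 ℚᵘ.* mkℚᵘ (+ n) 0        ≈⟨ ℚᵘ.*-cong (toℚᵘ-ι m) (toℚᵘ-ι n) ⟨
  ℚ.toℚᵘ (ι m) ℚᵘ.* ℚ.toℚᵘ (ι n)        ≈⟨ ℚ.toℚᵘ-homo-* (ι m) (ι n) ⟨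
  ℚ.toℚᵘ (ι m ℚ.* ι n)                  ∎)
  where open ℚᵘ.≃-Reasoning

ι-mono-≤ : ∀ {m n} → m ℕ.≤ n → ι m ℚ.≤ ι n
ι-mono-≤ {m} {n} m≤n = ℚ.toℚᵘ-cancel-≤ (begin
  ℚ.toℚᵘ (ι m)    ≃⟨ toℚᵘ-ι m ⟩
  mkℚᵘ (+ m) 0    ≤⟨ ℚᵘ.*≤* (ℤ.*-monoʳ-≤-nonNeg (+ 1) (ℤ.+≤+ m≤n)) ⟩
  mkℚᵘ (+ n) 0    ≃⟨ toℚᵘ-ι n ⟨
  ℚ.toℚᵘ (ι n)    ∎)
  where open ℚᵘ.≤-Reasoning

ι-mono-< : ∀ {m n} → m ℕ.< n → ι m ℚ.< ι n
ι-mono-< {m} {n} m<n = begin-strict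
  ι m           ≡⟨ ℚ.+-identityˡ (ι m) ⟨
  0ℚ ℚ.+ ι m    <⟨ ℚ.+-monoˡ-< (ι m) (ℚ.positive⁻¹ 1ℚ) ⟩
  1ℚ ℚ.+ ι m    ≡⟨ ι-+ 1 m ⟨
  ι (suc m)     ≤⟨ ι-mono-≤ m<n ⟩
  ι n           ∎
  where open ℚ.≤-Reasoning

0≤ι : ∀ n → 0ℚ ℚ.≤ ι n
0≤ι n = ι-mono-≤ {0} {n} ℕ.z≤n

-- The absolute value of the numerator serves as the bound, because the denominator is at least 1.
archimedean : ∀ p → ∃[ N ] p ℚ.≤ ι N
archimedean p@(ℚ.mkℚ n d-1 _) = ℤ.∣ n ∣ , ℚ.toℚᵘ-cancel-≤ (begin
  mkℚᵘ n d-1             ≤⟨ ℚᵘ.*≤* le ⟩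
  mkℚᵘ (+ ℤ.∣ n ∣) 0     ≃⟨ toℚᵘ-ι ℤ.∣ n ∣ ⟨
  ℚ.toℚᵘ (ι ℤ.∣ n ∣)     ∎)
  where
  open ℚᵘ.≤-Reasoning
  i≤∣i∣ : ∀ i → i ℤ.≤ + ℤ.∣ i ∣
  i≤∣i∣ (+ i)      = ℤ.≤-refl
  i≤∣i∣ ℤ.-[1+ i ] = ℤ.-≤+
  le : n ℤ.* + 1 ℤ.≤ + ℤ.∣ n ∣ ℤ.* + suc d-1
  le = ℤ.≤-trans (ℤ.*-monoʳ-≤-nonNeg (+ 1) (i≤∣i∣ n))
    (ℤ.*-monoˡ-≤-nonNeg (+ ℤ.∣ n ∣) (ℤ.+≤+ (ℕ.s≤s ℕ.z≤n)))

module _ (j : ℕ) where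

  private instance
    ι-suc-nonZero : ℚ.NonZero (ι (suc j))
    ι-suc-nonZero = ℚ.pos⇒nonZero (ι (suc j)) {{ℚ.positive (ι-mono-< {0} {suc j} (ℕ.s≤s ℕ.z≤n))}}

  opaque

    1/suc : ℚ
    1/suc = ℚ.1/ ι (suc j)

    1/suc-inverse : ι (suc j) ℚ.* 1/suc ≡ 1ℚ
    1/suc-inverse = ℚ.*-inverseʳ (ι (suc j))

    0<1/suc : 0ℚ ℚ.< 1/suc
    0<1/suc = ℚ.positive⁻¹ 1/suc {{ℚ.1/pos⇒pos (ι (suc j)) {{ℚ.positive (ι-mono-< {0} {suc j} (ℕ.s≤s ℕ.z≤n))}}}}

-- If N ≥ p/δ, then p = δ(p/δ) ≤ δ(j + 1) for every j ≥ N.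
*1/suc→0 : ∀ p δ → 0ℚ ℚ.< δ → ∃[ N ] ∀ j → N ℕ.≤ j → p ℚ.* 1/suc j ℚ.≤ δ
*1/suc→0 p δ 0<δ with archimedean (p ℚ.* (ℚ.1/ δ) {{ℚ.pos⇒nonZero δ {{ℚ.positive 0<δ}}}})
... | N , p/δ≤N = N , λ j N≤j → begin
  p ℚ.* 1/suc j                                       ≡⟨ cong (ℚ._* 1/suc j) p≡ ⟩
  (δ ℚ.* (p ℚ.* ℚ.1/ δ)) ℚ.* 1/suc j                  ≤⟨ ℚ.*-monoʳ-≤-nonNeg (1/suc j) {{ℚ.nonNegative (ℚ.<⇒≤ (0<1/suc j))}}
                                                          (ℚ.*-monoˡ-≤-nonNeg δ {{ℚ.pos⇒nonNeg δ}}
                                                             (ℚ.≤-trans p/δ≤N (ι-mono-≤ (ℕ.m≤n⇒m≤1+n N≤j)))) ⟩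
  (δ ℚ.* ι (suc j)) ℚ.* 1/suc j                       ≡⟨ ℚ.*-assoc δ (ι (suc j)) (1/suc j) ⟩
  δ ℚ.* (ι (suc j) ℚ.* 1/suc j)                       ≡⟨ cong (δ ℚ.*_) (1/suc-inverse j) ⟩
  δ ℚ.* 1ℚ                                            ≡⟨ ℚ.*-identityʳ δ ⟩
  δ                                                   ∎
  where
  open ℚ.≤-Reasoning
  instance
    δ-pos : ℚ.Positive δ
    δ-pos = ℚ.positive 0<δ
    δ-nonZero : ℚ.NonZero δ
    δ-nonZero = ℚ.pos⇒nonZero δ
  p≡ : p ≡ δ ℚ.* (p ℚ.* ℚ.1/ δ)
  p≡ = sym (trans (solve 3 (λ d p e → d :* (p :* e) := p :* (d :* e)) refl δ p (ℚ.1/ δ))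
    (trans (cong (p ℚ.*_) (ℚ.*-inverseʳ δ)) (ℚ.*-identityʳ p)))
    where open +-*-Solver

-- Passing from n to n + 1 raises the root by at most one, since (a + 2)² exceeds (a + 1)²; a single
-- comparison decides whether it does.
isqrt : ∀ n → ∃[ a ] a ℕ.* a ℕ.≤ n × n ℕ.< suc a ℕ.* suc a
isqrt zero = 0 , ℕ.z≤n , ℕ.s≤s ℕ.z≤n
isqrt (suc n) with isqrt n
... | a , a²≤n , n<[1+a]² with suc a ℕ.* suc a ℕ.≤? suc n
...   | yes le = suc a , le , ℕ.<-≤-trans (ℕ.s≤s n<[1+a]²)
                   (ℕ.*-mono-< (ℕ.n<1+n (suc a)) (ℕ.n<1+n (suc a)))
...   | no nle = a , ℕ.m≤n⇒m≤1+n a²≤n , ℕ.≰⇒> nle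

-- Real arithmetic and order

Eventually : (ℕ → Set) → Set
Eventually P = ∃[ N ] ∀ n → N ℕ.≤ n → P n

zipEventually : ∀ {P Q R : ℕ → Set} → (∀ n → P n → Q n → R n) →
  Eventually P → Eventually Q → Eventually R
zipEventually f (M , p) (N , q) = M ℕ.⊔ N , λ n ≤n →
  f n (p n (ℕ.m⊔n≤o⇒m≤o M N ≤n)) (q n (ℕ.m⊔n≤o⇒n≤o M N ≤n))

mapEventually : ∀ {P Q : ℕ → Set} → (∀ n → P n → Q n) → Eventually P → Eventually Q
mapEventually f (M , p) = M , λ n ≤n → f n (p n ≤n)

bounded : ∀ x → ∃[ K ] 0ℚ ℚ.< K × Eventually λ n → ℚ.∣ seq x n ∣ ℚ.≤ K
bounded x with cauchy x 1ℚ (ℚ.positive⁻¹ 1ℚ)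
... | N , close = ℚ.∣ seq x N ∣ ℚ.+ 1ℚ , ℚ.+-mono-≤-< (ℚ.0≤∣p∣ (seq x N)) (ℚ.positive⁻¹ 1ℚ) , N , λ n N≤n → begin
  ℚ.∣ seq x n ∣                              ≡⟨ cong ℚ.∣_∣ (solve 2 (λ p q → p := q :+ (p :- q)) refl (seq x n) (seq x N)) ⟩
  ℚ.∣ seq x N ℚ.+ (seq x n ℚ.- seq x N) ∣    ≤⟨ ℚ.∣p+q∣≤∣p∣+∣q∣ (seq x N) (seq x n ℚ.- seq x N) ⟩
  ℚ.∣ seq x N ∣ ℚ.+ ℚ.∣ seq x n ℚ.- seq x N ∣ ≤⟨ ℚ.+-monoʳ-≤ ℚ.∣ seq x N ∣ (close n N N≤n ℕ.≤-refl) ⟩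
  ℚ.∣ seq x N ∣ ℚ.+ 1ℚ                       ∎
  where open ℚ.≤-Reasoning
        open +-*-Solver

-- _≈_ and _<_ unfold to types mentioning only the sequences of their
-- arguments; the wrappers below make the arguments inferable.

infix 4 _≋_ _≺_

record _≋_ (x y : ℝ) : Set where
  constructor mk≋
  field ≋⇒≈ : x ≈ y
open _≋_ public

record _≺_ (x y : ℝ) : Set where
  constructor mk≺
  field ≺⇒< : x < y
open _≺_ public

pointwise : ∀ {x y} → (∀ n → seq x n ≡ seq y n) → x ≋ y
pointwise {x} {y} eq = mk≋ λ δ 0<δ → 0 , λ n _ →
  subst (λ p → ℚ.∣ seq x n ℚ.- p ∣ ℚ.≤ δ) (eq n)
    (subst (ℚ._≤ δ) (sym (cong ℚ.∣_∣ (ℚ.+-inverseʳ (seq x n)))) (ℚ.<⇒≤ 0<δ))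

≋-refl : ∀ {x} → x ≋ x
≋-refl = pointwise λ _ → refl

≋-sym : ∀ {x y} → x ≋ y → y ≋ x
≋-sym {x} {y} (mk≋ x≈y) = mk≋ λ δ 0<δ → mapEventually
  (λ n → subst (ℚ._≤ δ) (trans (sym (ℚ.∣-p∣≡∣p∣ (seq x n ℚ.- seq y n)))
    (cong ℚ.∣_∣ (neg-minus (seq x n) (seq y n)))))
  (x≈y δ 0<δ)

∣p+q∣≤δ : ∀ {p q δ} → ℚ.∣ p ∣ ℚ.≤ ½ ℚ.* δ → ℚ.∣ q ∣ ℚ.≤ ½ ℚ.* δ → ℚ.∣ p ℚ.+ q ∣ ℚ.≤ δ
∣p+q∣≤δ {p} {q} {δ} p≤ q≤ = begin
  ℚ.∣ p ℚ.+ q ∣             ≤⟨ ℚ.∣p+q∣≤∣p∣+∣q∣ p q ⟩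
  ℚ.∣ p ∣ ℚ.+ ℚ.∣ q ∣       ≤⟨ ℚ.+-mono-≤ p≤ q≤ ⟩
  ½ ℚ.* δ ℚ.+ ½ ℚ.* δ       ≡⟨ halves δ ⟩
  δ                         ∎
  where open ℚ.≤-Reasoning

≋-trans : ∀ {x y z} → x ≋ y → y ≋ z → x ≋ z
≋-trans {x} {y} {z} (mk≋ x≈y) (mk≋ y≈z) = mk≋ λ δ 0<δ → zipEventually
  (λ n p q → subst (λ d → ℚ.∣ d ∣ ℚ.≤ δ) (telescope (seq x n) (seq y n) (seq z n)) (∣p+q∣≤δ p q))
  (x≈y (½ ℚ.* δ) (0<½* 0<δ)) (y≈z (½ ℚ.* δ) (0<½* 0<δ))
  where
  telescope : ∀ p q r → (p ℚ.- q) ℚ.+ (q ℚ.- r) ≡ p ℚ.- r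
  telescope = solve 3 (λ p q r → (p :- q) :+ (q :- r) := p :- r) refl
    where open +-*-Solver

-- Transparent operations would let the unifier unfold and compare the moduli of sums and products.

infixl 6 _+_ _-_
infixl 7 _*_
infix  8 -_

opaque

  _+_ _*_ : ℝ → ℝ → ℝ
  _+_ = Defs._+_
  _*_ = Defs._*_

  -_ : ℝ → ℝ
  -_ = Defs.-_

_-_ : ℝ → ℝ → ℝ
x - y = x + (- y)

opaque
  unfolding _+_ _*_ -_

  +-cong : ∀ {x x′ y y′} → x ≋ x′ → y ≋ y′ → x + y ≋ x′ + y′
  +-cong {x} {x′} {y} {y′} (mk≋ x≈) (mk≋ y≈) = mk≋ λ δ 0<δ → zipEventually
    (λ n p q → subst (λ d → ℚ.∣ d ∣ ℚ.≤ δ)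
      (regroup (seq x n) (seq x′ n) (seq y n) (seq y′ n)) (∣p+q∣≤δ p q))
    (x≈ (½ ℚ.* δ) (0<½* 0<δ)) (y≈ (½ ℚ.* δ) (0<½* 0<δ))
    where
    regroup : ∀ a b c d → (a ℚ.- b) ℚ.+ (c ℚ.- d) ≡ (a ℚ.+ c) ℚ.- (b ℚ.+ d)
    regroup = solve 4 (λ a b c d → (a :- b) :+ (c :- d) := (a :+ c) :- (b :+ d)) refl
      where open +-*-Solver

  -‿cong : ∀ {x y} → x ≋ y → - x ≋ - y
  -‿cong {x} {y} x≋y = mk≋ λ δ 0<δ → mapEventually
    (λ n → subst (λ d → ℚ.∣ d ∣ ℚ.≤ δ) (flip (seq x n) (seq y n)))
    (≋⇒≈ (≋-sym x≋y) δ 0<δ)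
    where
    flip : ∀ a b → b ℚ.- a ≡ (ℚ.- a) ℚ.- (ℚ.- b)
    flip = solve 2 (λ a b → b :- a := (:- a) :- (:- b)) refl
      where open +-*-Solver

  -- The fixed factor is eventually bounded by some K, so it suffices that y and z agree up to δ/K.
  -- Congruence in both factors then follows by commutativity.
  *-congˡ : ∀ x {y z} → y ≋ z → x * y ≋ x * z
  *-congˡ x {y} {z} (mk≋ y≈z) = mk≋ (from (bounded x))
    where
    open ℚ.≤-Reasoning
    factor : ∀ a b c → a ℚ.* b ℚ.- a ℚ.* c ≡ a ℚ.* (b ℚ.- c)
    factor = solve 3 (λ a b c → a :* b :- a :* c := a :* (b :- c)) refl
      where open +-*-Solver
    from : (∃[ K ] 0ℚ ℚ.< K × Eventually λ n → ℚ.∣ seq x n ∣ ℚ.≤ K) → x * y ≈ x * z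
    from (K , 0<K , x≤K) δ 0<δ = zipEventually
      (λ n x≤K close → begin
        ℚ.∣ seq x n ℚ.* seq y n ℚ.- seq x n ℚ.* seq z n ∣
          ≡⟨ cong ℚ.∣_∣ (factor (seq x n) (seq y n) (seq z n)) ⟩
        ℚ.∣ seq x n ℚ.* (seq y n ℚ.- seq z n) ∣
          ≡⟨ ℚ.∣p*q∣≡∣p∣*∣q∣ (seq x n) (seq y n ℚ.- seq z n) ⟩
        ℚ.∣ seq x n ∣ ℚ.* ℚ.∣ seq y n ℚ.- seq z n ∣
          ≤⟨ *-mono-≤-nonNeg (ℚ.<⇒≤ 0<K) (ℚ.0≤∣p∣ (seq y n ℚ.- seq z n)) x≤K close ⟩
        K ℚ.* (ℚ.1/ K ℚ.* δ)
          ≡⟨ ℚ.*-assoc K (ℚ.1/ K) δ ⟨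
        (K ℚ.* ℚ.1/ K) ℚ.* δ
          ≡⟨ cong (ℚ._* δ) (ℚ.*-inverseʳ K) ⟩
        1ℚ ℚ.* δ
          ≡⟨ ℚ.*-identityˡ δ ⟩
        δ ∎)
      x≤K
      (y≈z (ℚ.1/ K ℚ.* δ) (0<* (ℚ.positive⁻¹ (ℚ.1/ K) {{ℚ.1/pos⇒pos K}}) 0<δ))
      where
      instance
        K-pos : ℚ.Positive K
        K-pos = ℚ.positive 0<K
        K-nonZero : ℚ.NonZero K
        K-nonZero = ℚ.pos⇒nonZero K

  *-comm : ∀ x y → x * y ≋ y * x
  *-comm x y = pointwise λ n → ℚ.*-comm (seq x n) (seq y n)

  +-assoc : ∀ x y z → (x + y) + z ≋ x + (y + z)
  +-assoc x y z = pointwise λ n → ℚ.+-assoc (seq x n) (seq y n) (seq z n)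

  +-comm : ∀ x y → x + y ≋ y + x
  +-comm x y = pointwise λ n → ℚ.+-comm (seq x n) (seq y n)

  +-identityʳ : ∀ x → x + 0ℝ ≋ x
  +-identityʳ x = pointwise λ n → ℚ.+-identityʳ (seq x n)

  -‿inverseʳ : ∀ x → x - x ≋ 0ℝ
  -‿inverseʳ x = pointwise λ n → ℚ.+-inverseʳ (seq x n)

  *-assoc : ∀ x y z → (x * y) * z ≋ x * (y * z)
  *-assoc x y z = pointwise λ n → ℚ.*-assoc (seq x n) (seq y n) (seq z n)

  *-identityʳ : ∀ x → x * 1ℝ ≋ x
  *-identityʳ x = pointwise λ n → ℚ.*-identityʳ (seq x n)

  *-distribˡ-+ : ∀ x y z → x * (y + z) ≋ x * y + x * z
  *-distribˡ-+ x y z = pointwise λ n → ℚ.*-distribˡ-+ (seq x n) (seq y n) (seq z n)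

  fromℚ-+ : ∀ p q → fromℚ (p ℚ.+ q) ≋ fromℚ p + fromℚ q
  fromℚ-+ p q = pointwise λ _ → refl

  fromℚ-* : ∀ p q → fromℚ (p ℚ.* q) ≋ fromℚ p * fromℚ q
  fromℚ-* p q = pointwise λ _ → refl

  fromℚ-neg : ∀ p → fromℚ (ℚ.- p) ≋ - fromℚ p
  fromℚ-neg p = pointwise λ _ → refl

*-cong : ∀ {x x′ y y′} → x ≋ x′ → y ≋ y′ → x * y ≋ x′ * y′
*-cong {x} {x′} {y} {y′} x≋x′ y≋y′ = ≋-trans (*-congˡ x y≋y′)
  (≋-trans (*-comm x y′) (≋-trans (*-congˡ y′ x≋x′) (*-comm y′ x′)))

ℝ-setoid : Setoid 0ℓ 0ℓ
ℝ-setoid = record { Carrier = ℝ ; _≈_ = _≋_ ; isEquivalence = record { refl = ≋-refl ; sym = ≋-sym ; trans = ≋-trans } }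

ℝ-commutativeRing : CommutativeRing 0ℓ 0ℓ
ℝ-commutativeRing = record
  { Carrier = ℝ ; _≈_ = _≋_ ; _+_ = _+_ ; _*_ = _*_ ; -_ = -_ ; 0# = 0ℝ ; 1# = 1ℝ
  ; isCommutativeRing = record
    { isRing = record
      { +-isAbelianGroup = record
        { isGroup = record
          { isMonoid = record
            { isSemigroup = record
              { isMagma = record
                { isEquivalence = Setoid.isEquivalence ℝ-setoid
                ; ∙-cong = +-cong }
              ; assoc = +-assoc }
            ; identity = comm∧idʳ⇒id +-comm +-identityʳ }
          ; inverse = comm∧invʳ⇒inv +-comm -‿inverseʳ
          ; ⁻¹-cong = -‿cong }
        ; comm = +-comm }
      ; *-cong = *-cong
      ; *-assoc = *-assoc
      ; *-identity = comm∧idʳ⇒id *-comm *-identityʳ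
      ; distrib = comm∧distrˡ⇒distr +-cong *-comm *-distribˡ-+ }
    ; *-comm = *-comm } }
  where open Algebra.Consequences.Setoid ℝ-setoid

open CommutativeRing ℝ-commutativeRing
  using (semiring; +-identityˡ; +-congˡ; +-congʳ; *-congʳ; zeroˡ; zeroʳ)
open Sum semiring using (sum; sum-cong-≋; sum-cong-≗; *-distribˡ-sum)

module ≋-Reasoning = SetoidReasoning ℝ-setoid

fromℚ-homomorphism : ℚ.+-*-rawRing ACR.-Raw-AlmostCommutative⟶ ACR.fromCommutativeRing ℝ-commutativeRing
fromℚ-homomorphism = record
  { ⟦_⟧ = fromℚ
  ; +-homo = fromℚ-+
  ; *-homo = fromℚ-*
  ; -‿homo = fromℚ-neg
  ; 0-homo = ≋-refl
  ; 1-homo = ≋-refl }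

fromℚ-weaklyDecidable : ∀ p q → Maybe (fromℚ p ≋ fromℚ q)
fromℚ-weaklyDecidable p q = Maybe.map (λ { refl → ≋-refl }) (dec⇒maybe (p ℚ.≟ q))

-- With rational coefficients `con (ι 2)` denotes `fromℕ 2`, so polynomial identities with numerals
-- are settled by normalisation.
module ℝ-Solver = Algebra.Solver.Ring ℚ.+-*-rawRing
  (ACR.fromCommutativeRing ℝ-commutativeRing) fromℚ-homomorphism fromℚ-weaklyDecidable

fromℕ-+ : ∀ m n → fromℕ (m ℕ.+ n) ≋ fromℕ m + fromℕ n
fromℕ-+ m n = ≋-trans (pointwise λ _ → ι-+ m n) (fromℚ-+ (ι m) (ι n))

fromℕ-* : ∀ m n → fromℕ (m ℕ.* n) ≋ fromℕ m * fromℕ n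
fromℕ-* m n = ≋-trans (pointwise λ _ → ι-* m n) (fromℚ-* (ι m) (ι n))

-- The strict order of the reals

≺-resp-≋ : ∀ {x x′ y y′} → x ≋ x′ → y ≋ y′ → x ≺ y → x′ ≺ y′
≺-resp-≋ {x} {x′} {y} {y′} (mk≋ x≈) (mk≋ y≈) (mk≺ (δ , 0<δ , gap)) =
  mk≺ (½ ℚ.* δ , 0<½* 0<δ , zipEventually (λ n → step n)
    (zipEventually (λ _ → _,_) (x≈ q 0<q) (y≈ q 0<q)) gap)
  where
  open ℚ.≤-Reasoning
  -- Each endpoint may move by a quarter of the gap, so half of it survives.
  q : ℚ
  q = ½ ℚ.* (½ ℚ.* δ)
  0<q : 0ℚ ℚ.< q
  0<q = 0<½* (0<½* 0<δ)
  step : ∀ n →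
    ℚ.∣ seq x n ℚ.- seq x′ n ∣ ℚ.≤ q × ℚ.∣ seq y n ℚ.- seq y′ n ∣ ℚ.≤ q →
    seq x n ℚ.+ δ ℚ.≤ seq y n → seq x′ n ℚ.+ ½ ℚ.* δ ℚ.≤ seq y′ n
  step n (cx , cy) le = begin
    a′ ℚ.+ ½ ℚ.* δ                   ≤⟨ ℚ.+-monoˡ-≤ (½ ℚ.* δ) (close⇒≥ a a′ cx) ⟩
    (a ℚ.+ q) ℚ.+ ½ ℚ.* δ            ≡⟨ solve 2 (λ a δ → (a :+ con ½ :* (con ½ :* δ)) :+ con ½ :* δ := (a :+ δ) :- con ½ :* (con ½ :* δ)) refl a δ ⟩
    (a ℚ.+ δ) ℚ.- q                  ≤⟨ ℚ.+-monoˡ-≤ (ℚ.- q) (ℚ.≤-trans le (close⇒≤ b b′ cy)) ⟩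
    (b′ ℚ.+ q) ℚ.- q                 ≡⟨ solve 2 (λ b q → (b :+ q) :- q := b) refl b′ q ⟩
    b′                               ∎
    where
    open +-*-Solver
    a  = seq x n
    a′ = seq x′ n
    b  = seq y n
    b′ = seq y′ n

opaque
  unfolding _+_ _*_ -_

  -- Together with its converse this reduces every comparison to a sign, so that estimates are
  -- needed only for sums, products and squares.
  x≺y⇒0≺y-x : ∀ {x y} → x ≺ y → 0ℝ ≺ y - x
  x≺y⇒0≺y-x {x} {y} (mk≺ (δ , 0<δ , gap)) = mk≺ (δ , 0<δ , mapEventually
    (λ n le → subst₂ ℚ._≤_ (lhs (seq x n) δ) refl (ℚ.+-monoˡ-≤ (ℚ.- seq x n) le)) gap)
    where
    lhs : ∀ a d → (a ℚ.+ d) ℚ.- a ≡ 0ℚ ℚ.+ d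
    lhs = solve 2 (λ a d → (a :+ d) :- a := con 0ℚ :+ d) refl
      where open +-*-Solver

  0≺y-x⇒x≺y : ∀ {x y} → 0ℝ ≺ y - x → x ≺ y
  0≺y-x⇒x≺y {x} {y} (mk≺ (δ , 0<δ , gap)) = mk≺ (δ , 0<δ , mapEventually
    (λ n le → subst₂ ℚ._≤_ (lhs (seq x n) δ) (rhs (seq x n) (seq y n)) (ℚ.+-monoˡ-≤ (seq x n) le)) gap)
    where
    open +-*-Solver
    lhs : ∀ a d → (0ℚ ℚ.+ d) ℚ.+ a ≡ a ℚ.+ d
    lhs = solve 2 (λ a d → (con 0ℚ :+ d) :+ a := a :+ d) refl
    rhs : ∀ a b → (b ℚ.- a) ℚ.+ a ≡ b
    rhs = solve 2 (λ a b → (b :- a) :+ a := b) refl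

fromℚ-mono-≺ : ∀ {p q} → p ℚ.< q → fromℚ p ≺ fromℚ q
fromℚ-mono-≺ {p} {q} p<q = mk≺ (q ℚ.- p , 0<q-p , 0 , λ _ _ → ℚ.≤-reflexive (cancel p q))
  where
  open +-*-Solver
  0<q-p : 0ℚ ℚ.< q ℚ.- p
  0<q-p = subst (ℚ._< q ℚ.- p) (ℚ.+-inverseʳ p) (ℚ.+-monoˡ-< (ℚ.- p) p<q)
  cancel : ∀ p q → p ℚ.+ (q ℚ.- p) ≡ q
  cancel = solve 2 (λ p q → p :+ (q :- p) := q) refl

fromℚ-cancel-≺ : ∀ {p q} → fromℚ p ≺ fromℚ q → p ℚ.< q
fromℚ-cancel-≺ {p} {q} (mk≺ (δ , 0<δ , N , gap)) = begin-strict
  p             ≡⟨ ℚ.+-identityʳ p ⟨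
  p ℚ.+ 0ℚ      <⟨ ℚ.+-monoʳ-< p 0<δ ⟩
  p ℚ.+ δ       ≤⟨ gap N ℕ.≤-refl ⟩
  q             ∎
  where open ℚ.≤-Reasoning

-- A Cauchy sequence can be tested at a single late index, so x ≮ 0 yields
-- lower bounds without excluded middle.
≮0⇒eventually≥ : ∀ {x} → ¬ (x ≺ 0ℝ) → ∀ ε → 0ℚ ℚ.< ε → Eventually λ n → 0ℚ ℚ.≤ seq x n ℚ.+ ε
≮0⇒eventually≥ {x} x≮0 ε 0<ε with cauchy x (½ ℚ.* (½ ℚ.* ε)) (0<½* (0<½* 0<ε))
... | N , close with seq x N ℚ.+ ½ ℚ.* ε ℚ.≤? 0ℚ
...   | yes le = contradiction (mk≺ (½ ℚ.* (½ ℚ.* ε) , 0<½* (0<½* 0<ε) , N , below)) x≮0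
  where
  open ℚ.≤-Reasoning
  open +-*-Solver
  below : ∀ n → N ℕ.≤ n → seq x n ℚ.+ ½ ℚ.* (½ ℚ.* ε) ℚ.≤ 0ℚ
  below n N≤n = begin
    seq x n ℚ.+ ½ ℚ.* (½ ℚ.* ε)
      ≤⟨ ℚ.+-monoˡ-≤ (½ ℚ.* (½ ℚ.* ε)) (close⇒≤ (seq x n) (seq x N) (close n N N≤n ℕ.≤-refl)) ⟩
    (seq x N ℚ.+ ½ ℚ.* (½ ℚ.* ε)) ℚ.+ ½ ℚ.* (½ ℚ.* ε)
      ≡⟨ solve 2 (λ a e → (a :+ con ½ :* (con ½ :* e)) :+ con ½ :* (con ½ :* e) := a :+ con ½ :* e) refl (seq x N) ε ⟩
    seq x N ℚ.+ ½ ℚ.* ε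
      ≤⟨ le ⟩
    0ℚ ∎
...   | no nle = N , λ n N≤n → begin
    0ℚ
      ≤⟨ ℚ.<⇒≤ (ℚ.≰⇒> nle) ⟩
    seq x N ℚ.+ ½ ℚ.* ε
      ≤⟨ ℚ.+-monoˡ-≤ (½ ℚ.* ε) (close⇒≥ (seq x n) (seq x N) (close n N N≤n ℕ.≤-refl)) ⟩
    (seq x n ℚ.+ ½ ℚ.* (½ ℚ.* ε)) ℚ.+ ½ ℚ.* ε
      ≤⟨ ℚ.+-monoˡ-≤ (½ ℚ.* ε) (ℚ.+-monoʳ-≤ (seq x n) (ℚ.*-monoˡ-≤-nonNeg ½ (½*p≤p (ℚ.<⇒≤ 0<ε)))) ⟩
    (seq x n ℚ.+ ½ ℚ.* ε) ℚ.+ ½ ℚ.* ε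
      ≡⟨ solve 2 (λ a e → (a :+ con ½ :* e) :+ con ½ :* e := a :+ e) refl (seq x n) ε ⟩
    seq x n ℚ.+ ε ∎
  where
  open ℚ.≤-Reasoning
  open +-*-Solver
  ½*p≤p : ∀ {p} → 0ℚ ℚ.≤ p → ½ ℚ.* p ℚ.≤ p
  ½*p≤p {p} 0≤p = begin
    ½ ℚ.* p                   ≡⟨ ℚ.+-identityʳ (½ ℚ.* p) ⟨
    ½ ℚ.* p ℚ.+ 0ℚ            ≤⟨ ℚ.+-monoʳ-≤ (½ ℚ.* p) (ℚ.*-monoˡ-≤-nonNeg ½ 0≤p) ⟩
    ½ ℚ.* p ℚ.+ ½ ℚ.* p       ≡⟨ halves p ⟩
    p                         ∎

opaque
  unfolding _+_ _*_ -_

  -- The negative hypothesis on y still bounds it below by -δ/2 from some index on, where δ is the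
  -- gap of x; half of the gap remains.
  0≺x+y : ∀ {x y} → 0ℝ ≺ x → ¬ (y ≺ 0ℝ) → 0ℝ ≺ x + y
  0≺x+y {x} {y} (mk≺ (δ , 0<δ , gap)) y≮0 = mk≺ (½ ℚ.* δ , 0<½* 0<δ , zipEventually
    (λ n x≥ y≥ → begin
      0ℚ ℚ.+ ½ ℚ.* δ
        ≡⟨ solve 1 (λ d → con 0ℚ :+ con ½ :* d := ((con 0ℚ :+ d) :+ con 0ℚ) :- con ½ :* d) refl δ ⟩
      ((0ℚ ℚ.+ δ) ℚ.+ 0ℚ) ℚ.- ½ ℚ.* δ
        ≤⟨ ℚ.+-monoˡ-≤ (ℚ.- (½ ℚ.* δ)) (ℚ.+-mono-≤ x≥ y≥) ⟩
      (seq x n ℚ.+ (seq y n ℚ.+ ½ ℚ.* δ)) ℚ.- ½ ℚ.* δ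
        ≡⟨ solve 3 (λ a b d → (a :+ (b :+ d)) :- d := a :+ b) refl (seq x n) (seq y n) (½ ℚ.* δ) ⟩
      seq x n ℚ.+ seq y n ∎)
    gap (≮0⇒eventually≥ y≮0 (½ ℚ.* δ) (0<½* 0<δ)))
    where
    open ℚ.≤-Reasoning
    open +-*-Solver

  0≺x*y : ∀ {x y} → 0ℝ ≺ x → 0ℝ ≺ y → 0ℝ ≺ x * y
  0≺x*y {x} {y} (mk≺ (δ , 0<δ , x-gap)) (mk≺ (ε , 0<ε , y-gap)) =
    mk≺ (δ ℚ.* ε , 0<* 0<δ 0<ε , zipEventually
    (λ n x≥ y≥ → begin
      0ℚ ℚ.+ δ ℚ.* ε
        ≡⟨ ℚ.+-identityˡ (δ ℚ.* ε) ⟩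
      δ ℚ.* ε
        ≤⟨ *-mono-≤-nonNeg (ℚ.≤-trans (ℚ.<⇒≤ 0<δ) (drop δ x≥)) (ℚ.<⇒≤ 0<ε) (drop δ x≥) (drop ε y≥) ⟩
      seq x n ℚ.* seq y n ∎) x-gap y-gap)
    where
    open ℚ.≤-Reasoning
    drop : ∀ p {q} → 0ℚ ℚ.+ p ℚ.≤ q → p ℚ.≤ q
    drop p = subst (ℚ._≤ _) (ℚ.+-identityˡ p)

  -- A gap below 0 is already absurd at one index, where the term is the square of a rational.
  x*x≮0 : ∀ x → ¬ (x * x ≺ 0ℝ)
  x*x≮0 x (mk≺ (δ , 0<δ , N , gap)) = ℚ.<-irrefl refl (begin-strict
    0ℚ                              <⟨ 0<δ ⟩
    δ                               ≡⟨ ℚ.+-identityˡ δ ⟨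
    0ℚ ℚ.+ δ                        ≤⟨ ℚ.+-monoˡ-≤ δ 0≤a² ⟩
    seq x N ℚ.* seq x N ℚ.+ δ       ≤⟨ gap N ℕ.≤-refl ⟩
    0ℚ                              ∎)
    where
    open ℚ.≤-Reasoning
    ∣a∣²≡a² : ∀ p → ℚ.∣ p ∣ ℚ.* ℚ.∣ p ∣ ≡ p ℚ.* p
    ∣a∣²≡a² p with ℚ.∣p∣≡p∨∣p∣≡-p p
    ... | inj₁ eq = cong₂ ℚ._*_ eq eq
    ... | inj₂ eq = trans (cong₂ ℚ._*_ eq eq)
      (solve 1 (λ p → (:- p) :* (:- p) := p :* p) refl p)
      where open +-*-Solver
    0≤a² : 0ℚ ℚ.≤ seq x N ℚ.* seq x N
    0≤a² = subst (0ℚ ℚ.≤_) (∣a∣²≡a² (seq x N))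
      (*-mono-≤-nonNeg (ℚ.0≤∣p∣ (seq x N)) ℚ.≤-refl (ℚ.0≤∣p∣ (seq x N)) (ℚ.0≤∣p∣ (seq x N)))

  -- If x ≥ δ and |xy| ≤ δε from some index on, then δ|y| ≤ |xy| ≤ δε there. This takes the place of
  -- dividing by x in the eigenvector argument.
  x*y≋0⇒y≋0 : ∀ {x y} → 0ℝ ≺ x → x * y ≋ 0ℝ → y ≋ 0ℝ
  x*y≋0⇒y≋0 {x} {y} (mk≺ (δ , 0<δ , gap)) (mk≋ xy≈0) = mk≋ λ ε 0<ε → zipEventually
    (λ n x≥ xy≤ → ℚ.*-cancelˡ-≤-pos δ {{ℚ.positive 0<δ}} (begin
      δ ℚ.* ℚ.∣ seq y n ℚ.- 0ℚ ∣
        ≡⟨ cong (λ d → δ ℚ.* ℚ.∣ d ∣) (ℚ.+-identityʳ (seq y n)) ⟩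
      δ ℚ.* ℚ.∣ seq y n ∣
        ≤⟨ ℚ.*-monoʳ-≤-nonNeg ℚ.∣ seq y n ∣ {{ℚ.∣-∣-nonNeg (seq y n)}}
             (ℚ.≤-trans (subst (ℚ._≤ seq x n) (ℚ.+-identityˡ δ) x≥) (p≤∣p∣ (seq x n))) ⟩
      ℚ.∣ seq x n ∣ ℚ.* ℚ.∣ seq y n ∣
        ≡⟨ ℚ.∣p*q∣≡∣p∣*∣q∣ (seq x n) (seq y n) ⟨
      ℚ.∣ seq x n ℚ.* seq y n ∣
        ≡⟨ cong ℚ.∣_∣ (ℚ.+-identityʳ (seq x n ℚ.* seq y n)) ⟨
      ℚ.∣ seq x n ℚ.* seq y n ℚ.- 0ℚ ∣
        ≤⟨ xy≤ ⟩
      δ ℚ.* ε ∎))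
    gap (xy≈0 (δ ℚ.* ε) (0<* 0<δ 0<ε))
    where open ℚ.≤-Reasoning

0≺x⇒x≮0 : ∀ {x} → 0ℝ ≺ x → ¬ (x ≺ 0ℝ)
0≺x⇒x≮0 (mk≺ (δ , 0<δ , M , x≥)) (mk≺ (ε , 0<ε , N , x≤)) = ℚ.<-irrefl refl (begin-strict
  0ℚ                        <⟨ ℚ.+-mono-< 0<δ 0<ε ⟩
  δ ℚ.+ ε                   ≡⟨ cong (ℚ._+ ε) (ℚ.+-identityˡ δ) ⟨
  (0ℚ ℚ.+ δ) ℚ.+ ε          ≤⟨ ℚ.+-monoˡ-≤ ε (x≥ (M ℕ.⊔ N) (ℕ.m≤m⊔n M N)) ⟩
  _                         ≤⟨ x≤ (M ℕ.⊔ N) (ℕ.m≤n⊔m M N) ⟩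
  0ℚ                        ∎)
  where open ℚ.≤-Reasoning

x≮y⇒x-y≮0 : ∀ {x y} → ¬ (x ≺ y) → ¬ (x - y ≺ 0ℝ)
x≮y⇒x-y≮0 {x} {y} x≮y x-y≺0 = x≮y (0≺y-x⇒x≺y
  (≺-resp-≋ ≋-refl (solve 2 (λ x y → con 0ℚ :- (x :- y) := y :- x) ≋-refl x y) (x≺y⇒0≺y-x x-y≺0)))
  where open ℝ-Solver

x≮0∧x≺y⇒0≺y : ∀ {x y} → ¬ (x ≺ 0ℝ) → x ≺ y → 0ℝ ≺ y
x≮0∧x≺y⇒0≺y {x} {y} x≮0 x≺y = ≺-resp-≋ ≋-refl
  (solve 2 (λ x y → (y :- x) :+ x := y) ≋-refl x y) (0≺x+y (x≺y⇒0≺y-x x≺y) x≮0)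
  where open ℝ-Solver

-- Factor y² - x² as (y - x)(y + x); the second factor is positive because y is positive and x is
-- not negative.
x≺y⇒x²≺y² : ∀ {x y} → ¬ (x ≺ 0ℝ) → x ≺ y → x * x ≺ y * y
x≺y⇒x²≺y² {x} {y} x≮0 x≺y = 0≺y-x⇒x≺y (≺-resp-≋ ≋-refl
  (solve 2 (λ x y → (y :- x) :* (y :+ x) := y :* y :- x :* x) ≋-refl x y)
  (0≺x*y (x≺y⇒0≺y-x x≺y) (0≺x+y (x≮0∧x≺y⇒0≺y x≮0 x≺y) x≮0)))
  where open ℝ-Solver

-- Square roots of natural numbers

module _ (n : ℕ) where

  private

    unscale : ∀ j → ι (n ℕ.* (suc j ℕ.* suc j)) ℚ.* (1/suc j ℚ.* 1/suc j) ≡ ι n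
    unscale j = begin
      ι (n ℕ.* (suc j ℕ.* suc j)) ℚ.* (t ℚ.* t)
        ≡⟨ cong (ℚ._* (t ℚ.* t)) (trans (ι-* n (suc j ℕ.* suc j)) (cong (ι n ℚ.*_) (ι-* (suc j) (suc j)))) ⟩
      (ι n ℚ.* (s ℚ.* s)) ℚ.* (t ℚ.* t)
        ≡⟨ solve 3 (λ n s t → (n :* (s :* s)) :* (t :* t) := n :* ((s :* t) :* (s :* t))) refl (ι n) s t ⟩
      ι n ℚ.* ((s ℚ.* t) ℚ.* (s ℚ.* t))
        ≡⟨ cong (λ p → ι n ℚ.* (p ℚ.* p)) (1/suc-inverse j) ⟩
      ι n ℚ.* (1ℚ ℚ.* 1ℚ)
        ≡⟨ ℚ.*-identityʳ (ι n) ⟩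
      ι n ∎
      where
      open ≡-Reasoning
      open +-*-Solver
      s = ι (suc j)
      t = 1/suc j

    scaled-square : ∀ a t → ι (a ℕ.* a) ℚ.* (t ℚ.* t) ≡ (ι a ℚ.* t) ℚ.* (ι a ℚ.* t)
    scaled-square a t = trans (cong (ℚ._* (t ℚ.* t)) (ι-* a a))
      (solve 2 (λ a t → (a :* a) :* (t :* t) := (a :* t) :* (a :* t)) refl (ι a) t)
      where open +-*-Solver

  opaque

    -- ⌊(j + 1)√n⌋ / (j + 1)
    sqrtApprox : ℕ → ℚ
    sqrtApprox j = ι (proj₁ (isqrt (n ℕ.* (suc j ℕ.* suc j)))) ℚ.* 1/suc j

    sqrtApprox-nonNeg : ∀ j → 0ℚ ℚ.≤ sqrtApprox j
    sqrtApprox-nonNeg j = 0≤* (0≤ι (proj₁ (isqrt (n ℕ.* (suc j ℕ.* suc j))))) (ℚ.<⇒≤ (0<1/suc j))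

    sqrtApprox²≤ : ∀ j → sqrtApprox j ℚ.* sqrtApprox j ℚ.≤ ι n
    sqrtApprox²≤ j = subst₂ ℚ._≤_ (scaled-square a (1/suc j)) (unscale j)
      (ℚ.*-monoʳ-≤-nonNeg (1/suc j ℚ.* 1/suc j) {{ℚ.nonNegative (ℚ.<⇒≤ (0<* (0<1/suc j) (0<1/suc j)))}}
        (ι-mono-≤ (proj₁ (proj₂ (isqrt (n ℕ.* (suc j ℕ.* suc j)))))))
      where
      a : ℕ
      a = proj₁ (isqrt (n ℕ.* (suc j ℕ.* suc j)))

    <[sqrtApprox+1/suc]² : ∀ j → ι n ℚ.<
      (sqrtApprox j ℚ.+ 1/suc j) ℚ.* (sqrtApprox j ℚ.+ 1/suc j)
    <[sqrtApprox+1/suc]² j = subst₂ ℚ._<_ (unscale j) (trans (scaled-square (suc a) (1/suc j)) (cong (λ p → p ℚ.* p) shift))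
      (ℚ.*-monoˡ-<-pos (1/suc j ℚ.* 1/suc j) {{ℚ.positive (0<* (0<1/suc j) (0<1/suc j))}}
        (ι-mono-< (proj₂ (proj₂ (isqrt (n ℕ.* (suc j ℕ.* suc j)))))))
      where
      a : ℕ
      a = proj₁ (isqrt (n ℕ.* (suc j ℕ.* suc j)))
      shift : ι (suc a) ℚ.* 1/suc j ≡ ι a ℚ.* 1/suc j ℚ.+ 1/suc j
      shift = trans (cong (ℚ._* 1/suc j) (ι-+ 1 a))
        (solve 2 (λ a t → (con 1ℚ :+ a) :* t := a :* t :+ t) refl (ι a) (1/suc j))
        where open +-*-Solver

  -- Both terms are compared through n, as xᵢ² ≤ n < (xⱼ + 1/(j + 1))². This gives the Cauchy
  -- property and, for j = 0, one bound for all terms.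
  sqrtApprox< : ∀ i j → sqrtApprox i ℚ.< sqrtApprox j ℚ.+ 1/suc j
  sqrtApprox< i j = p²<q²⇒p<q (ℚ.+-mono-≤ (sqrtApprox-nonNeg j) (ℚ.<⇒≤ (0<1/suc j)))
    (ℚ.≤-<-trans (sqrtApprox²≤ i) (<[sqrtApprox+1/suc]² j))

  sqrt : ℝ
  sqrt = mkℝ sqrtApprox λ δ 0<δ → let (N , small) = *1/suc→0 1ℚ δ 0<δ in N , λ i j N≤i N≤j →
    ≤⇒close (sqrtApprox i) (sqrtApprox j)
      (ℚ.≤-trans (ℚ.<⇒≤ (sqrtApprox< i j)) (ℚ.+-monoʳ-≤ (sqrtApprox j)
        (subst (ℚ._≤ δ) (ℚ.*-identityˡ (1/suc j)) (small j N≤j))))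
      (ℚ.≤-trans (ℚ.<⇒≤ (sqrtApprox< j i)) (ℚ.+-monoʳ-≤ (sqrtApprox i)
        (subst (ℚ._≤ δ) (ℚ.*-identityˡ (1/suc i)) (small i N≤i))))

  sqrt≮0 : ¬ (sqrt ≺ 0ℝ)
  sqrt≮0 (mk≺ (δ , 0<δ , N , gap)) = ℚ.<-irrefl refl (ℚ.<-≤-trans
    (ℚ.+-mono-≤-< (sqrtApprox-nonNeg N) 0<δ) (gap N ℕ.≤-refl))

  sqrt²≈n : (sqrt Defs.* sqrt) ≈ fromℕ n
  sqrt²≈n δ 0<δ = let (N , small) = *1/suc→0 C δ 0<δ in N , λ j N≤j →
    ≤⇒close (sqrtApprox j ℚ.* sqrtApprox j) (ι n)
      (ℚ.≤-trans (sqrtApprox²≤ j) (ℚ.≤-trans (ℚ.≤-reflexive (sym (ℚ.+-identityʳ (ι n)))) (ℚ.+-monoʳ-≤ (ι n) (ℚ.<⇒≤ 0<δ))))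
      (ℚ.≤-trans (ℚ.<⇒≤ (<[sqrtApprox+1/suc]² j)) (ℚ.≤-trans (expand j) (ℚ.+-monoʳ-≤ (sqrtApprox j ℚ.* sqrtApprox j) (small j N≤j))))
    where
    open ℚ.≤-Reasoning
    -- `B` bounds every approximation x, and t = 1/(j + 1) is at most 1. So `C` bounds 2x + t, the
    -- coefficient of t in (x + t)² - x².
    B C : ℚ
    B = sqrtApprox 0 ℚ.+ 1/suc 0
    C = B ℚ.+ (B ℚ.+ 1ℚ)
    expand : ∀ j → (sqrtApprox j ℚ.+ 1/suc j) ℚ.* (sqrtApprox j ℚ.+ 1/suc j) ℚ.≤
      sqrtApprox j ℚ.* sqrtApprox j ℚ.+ C ℚ.* 1/suc j
    expand j = begin
      (x ℚ.+ t) ℚ.* (x ℚ.+ t)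
        ≡⟨ solve 2 (λ x t → (x :+ t) :* (x :+ t) := x :* x :+ (x :+ (x :+ t)) :* t) refl x t ⟩
      x ℚ.* x ℚ.+ (x ℚ.+ (x ℚ.+ t)) ℚ.* t
        ≤⟨ ℚ.+-monoʳ-≤ (x ℚ.* x) (ℚ.*-monoʳ-≤-nonNeg t {{ℚ.nonNegative (ℚ.<⇒≤ (0<1/suc j))}}
             (ℚ.+-mono-≤ x≤B (ℚ.+-mono-≤ x≤B t≤1))) ⟩
      x ℚ.* x ℚ.+ C ℚ.* t ∎
      where
      open +-*-Solver
      x = sqrtApprox j
      t = 1/suc j
      x≤B : x ℚ.≤ B
      x≤B = ℚ.<⇒≤ (sqrtApprox< j 0)
      t≤1 : t ℚ.≤ 1ℚ
      t≤1 = begin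
        t                       ≡⟨ ℚ.*-identityˡ t ⟨
        1ℚ ℚ.* t                ≤⟨ ℚ.*-monoʳ-≤-nonNeg t {{ℚ.nonNegative (ℚ.<⇒≤ (0<1/suc j))}} (ι-mono-≤ {1} {suc j} (ℕ.s≤s ℕ.z≤n)) ⟩
        ι (suc j) ℚ.* t         ≡⟨ 1/suc-inverse j ⟩
        1ℚ                      ∎

  opaque
    unfolding _*_

    sqrt²≋n : sqrt * sqrt ≋ fromℕ n
    sqrt²≋n = mk≋ sqrt²≈n

-- The spectrum of T(2,b)

≋-reflexive : ∀ {x y} → x ≡ y → x ≋ y
≋-reflexive refl = ≋-refl

sum-↑ : ∀ m {n} (t : Fin (m ℕ.+ n) → ℝ) → sum t ≋ sum (t ∘ (_↑ˡ n)) + sum (t ∘ (m ↑ʳ_))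
sum-↑ zero    t = ≋-sym (+-identityˡ (sum t))
sum-↑ (suc m) {n} t = ≋-trans (+-congˡ (sum-↑ m (t ∘ suc)))
  (≋-sym (+-assoc (t zero) (sum (t ∘ suc ∘ (_↑ˡ n))) (sum (t ∘ suc ∘ (m ↑ʳ_)))))

sum-const : ∀ n x → sum {n} (λ _ → x) ≋ fromℕ n * x
sum-const zero    x = ≋-sym (zeroˡ x)
sum-const (suc n) x = begin
  x + sum {n} (λ _ → x)          ≈⟨ +-congˡ (sum-const n x) ⟩
  x + fromℕ n * x                ≈⟨ solve 2 (λ x n → x :+ n :* x := (con 1ℚ :+ n) :* x) ≋-refl x (fromℕ n) ⟩
  (1ℝ + fromℕ n) * x             ≈⟨ *-congʳ (fromℕ-+ 1 n) ⟨
  fromℕ (suc n) * x              ∎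
  where open ≋-Reasoning
        open ℝ-Solver

-- Stated for an arbitrary graph: on a concrete one, comparing the two sums would unfold their moduli.

module _ (G : Graph) (M : Graph.Vertex G → Graph.Vertex G → ℝ) where

  open Graph G

  IsEigenvector : ℝ → (Vertex → ℝ) → Set
  IsEigenvector μ f = ¬ (∀ x → f x ≋ 0ℝ) ×
    (∀ x → sum (λ i → M x (vertex i) * f (vertex i)) ≋ μ * f x)

  opaque
    unfolding _+_ _*_

    eigenvector⇒eigenvalue : ∀ {μ f} → IsEigenvector μ f → IsEigenvalue G M μ
    eigenvector⇒eigenvalue {μ} {f} (f≉0 , eq) =
      f , (λ f≈0 → f≉0 λ x → mk≋ (f≈0 x)) , λ x → ≋⇒≈ (eq x)

    eigenvalue⇒eigenvector : ∀ {μ} → IsEigenvalue G M μ → ∃[ f ] IsEigenvector μ f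
    eigenvalue⇒eigenvector (f , f≉0 , eq) =
      f , (λ f≋0 → f≉0 λ x → ≋⇒≈ {f x} {0ℝ} (f≋0 x)) , λ x → mk≋ (eq x)

module _ {k : ℕ} where

  open Graph (T2Graph k) using (vertex; enumeration)

  sum-vertex : (g : T2Vertex (suc k) → ℝ) →
    sum (g ∘ vertex) ≋ sum (g ∘ u) + (g v + sum (g ∘ w))
  sum-vertex g = ≋-trans (sum-↑ (suc k) (g ∘ vertex)) (≋-reflexive
    (cong₂ _+_ (sum-cong-≗ λ i → at (u i))
      (cong₂ _+_ (at v) (sum-cong-≗ λ i → at (w i)))))
    where
    -- On the blocks of the index set `vertex` is stuck for variable k, whereas
    -- `Inverse.from enumeration` computes to the block indices; the inverse law then identifies the
    -- summands.
    at : ∀ x → g (vertex (Inverse.from enumeration x)) ≡ g x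
    at x = cong g (Inverse.strictlyInverseˡ enumeration x)

  neighbourSum : (T2Vertex (suc k) → ℝ) → T2Vertex (suc k) → ℝ
  neighbourSum f (u zero)    = sum (f ∘ u ∘ suc) + f v
  neighbourSum f (u (suc _)) = f (u zero)
  neighbourSum f v           = f (u zero) + f (w zero)
  neighbourSum f (w zero)    = sum (f ∘ w ∘ suc) + f v
  neighbourSum f (w (suc _)) = f (w zero)

  adjacencyMatrix-row : ∀ f x →
    sum (λ i → adjacencyMatrix (T2Graph k) x (vertex i) * f (vertex i)) ≋ neighbourSum f x
  adjacencyMatrix-row f x = ≋-trans (sum-vertex (λ y → adjacencyMatrix (T2Graph k) x y * f y)) (cases x)
    where
    open ℝ-Solver
    U W : ℝ
    U = sum (f ∘ u ∘ suc)
    W = sum (f ∘ w ∘ suc)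
    collect : ∀ c (t : Fin k → ℝ) → sum (λ i → c * t i) ≋ c * sum t
    collect c t = ≋-sym (*-distribˡ-sum c t)
    -- Every row is constant on the leaves of each star, so five entries describe it: those in the
    -- columns u₁, uᵢ, v, w₁ and wᵢ.
    expand : ∀ a b c d e →
      (a * f (u zero) + sum (λ i → b * f (u (suc i)))) +
        (c * f v + (d * f (w zero) + sum (λ i → e * f (w (suc i))))) ≋
      (a * f (u zero) + b * U) + (c * f v + (d * f (w zero) + e * W))
    expand a b c d e = +-cong (+-congˡ (collect b (f ∘ u ∘ suc)))
      (+-congˡ (+-congˡ (collect e (f ∘ w ∘ suc))))
    cases : ∀ x → sum (λ i → adjacencyMatrix (T2Graph k) x (u i) * f (u i)) +
      (adjacencyMatrix (T2Graph k) x v * f v +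
        sum (λ i → adjacencyMatrix (T2Graph k) x (w i) * f (w i))) ≋ neighbourSum f x
    cases (u zero) = ≋-trans (expand 0ℝ 1ℝ 1ℝ 0ℝ 0ℝ)
      (solve 5 (λ p x y q z → (con 0ℚ :* p :+ con 1ℚ :* x) :+ (con 1ℚ :* y :+ (con 0ℚ :* q :+ con 0ℚ :* z)) := x :+ y)
        ≋-refl (f (u zero)) U (f v) (f (w zero)) W)
    cases (u (suc i)) = ≋-trans (expand 1ℝ 0ℝ 0ℝ 0ℝ 0ℝ)
      (solve 5 (λ p x y q z → (con 1ℚ :* p :+ con 0ℚ :* x) :+ (con 0ℚ :* y :+ (con 0ℚ :* q :+ con 0ℚ :* z)) := p)
        ≋-refl (f (u zero)) U (f v) (f (w zero)) W)
    cases v = ≋-trans (expand 1ℝ 0ℝ 0ℝ 1ℝ 0ℝ)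
      (solve 5 (λ p x y q z → (con 1ℚ :* p :+ con 0ℚ :* x) :+ (con 0ℚ :* y :+ (con 1ℚ :* q :+ con 0ℚ :* z)) := p :+ q)
        ≋-refl (f (u zero)) U (f v) (f (w zero)) W)
    cases (w zero) = ≋-trans (expand 0ℝ 0ℝ 1ℝ 0ℝ 1ℝ)
      (solve 5 (λ p x y q z → (con 0ℚ :* p :+ con 0ℚ :* x) :+ (con 1ℚ :* y :+ (con 0ℚ :* q :+ con 1ℚ :* z)) := z :+ y)
        ≋-refl (f (u zero)) U (f v) (f (w zero)) W)
    cases (w (suc i)) = ≋-trans (expand 0ℝ 0ℝ 0ℝ 1ℝ 0ℝ)
      (solve 5 (λ p x y q z → (con 0ℚ :* p :+ con 0ℚ :* x) :+ (con 0ℚ :* y :+ (con 1ℚ :* q :+ con 0ℚ :* z)) := q)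
        ≋-refl (f (u zero)) U (f v) (f (w zero)) W)

  -- With p, q, y the values at u₁, w₁, v and d = ν² − k, the equations give d p = ν y = d q,
  -- hence d ν y = d (p + q) = 2 ν y, that is, (ν² − (k + 2)) ν y = 0.
  no-larger-eigenvalue : ∀ {ν} → 0ℝ ≺ ν → fromℕ (2 ℕ.+ k) ≺ ν * ν →
    ¬ IsEigenvalue (T2Graph k) (adjacencyMatrix (T2Graph k)) ν
  no-larger-eigenvalue {ν} 0≺ν k+2≺ν² eigenvalue = f≉0 f≋0
    where
    open ≋-Reasoning
    open ℝ-Solver
    f : T2Vertex (suc k) → ℝ
    f = proj₁ (eigenvalue⇒eigenvector (T2Graph k) (adjacencyMatrix (T2Graph k)) eigenvalue)
    f≉0 : ¬ (∀ x → f x ≋ 0ℝ)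
    f≉0 = proj₁ (proj₂ (eigenvalue⇒eigenvector (T2Graph k) (adjacencyMatrix (T2Graph k)) eigenvalue))
    equations : ∀ x → neighbourSum f x ≋ ν * f x
    equations x = ≋-trans (≋-sym (adjacencyMatrix-row f x)) (proj₂ (proj₂ (eigenvalue⇒eigenvector (T2Graph k) (adjacencyMatrix (T2Graph k)) eigenvalue)) x)
    y e κ : ℝ
    y = f v
    κ = fromℕ k
    e = ν * ν - fromℕ (2 ℕ.+ k)
    -- The hypothesis on ν² makes e positive, hence also d = e + 2; e is cancelled to get y = 0, and
    -- d to get the zeros at the centres.
    d≋ : ν * ν - κ ≋ e + fromℕ 2
    d≋ = begin
      ν * ν - κ                               ≈⟨ solve 3 (λ s κ t → s :- κ := (s :- (t :+ κ)) :+ t) ≋-refl (ν * ν) κ (fromℕ 2) ⟩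
      (ν * ν - (fromℕ 2 + κ)) + fromℕ 2       ≈⟨ +-congʳ (+-congˡ (-‿cong (fromℕ-+ 2 k))) ⟨
      e + fromℕ 2                             ∎
    0≺e : 0ℝ ≺ e
    0≺e = x≺y⇒0≺y-x k+2≺ν²
    0≺d : 0ℝ ≺ ν * ν - κ
    0≺d = ≺-resp-≋ ≋-refl (≋-sym d≋) (0≺x+y 0≺e (0≺x⇒x≮0 (fromℚ-mono-≺ (ι-mono-< {0} {2} (ℕ.s≤s ℕ.z≤n)))))
    -- Multiplying the centre equation by ν turns the sum of the leaf values into k copies of the
    -- centre value.
    side : ∀ c (l : Fin k → ℝ) → (∀ i → c ≋ ν * l i) → sum l + y ≋ ν * c →
      (ν * ν - κ) * c ≋ ν * y
    side c l leaf centre = begin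
      (ν * ν - κ) * c               ≈⟨ solve 3 (λ ν κ c → (ν :* ν :- κ) :* c := ν :* (ν :* c) :- κ :* c) ≋-refl ν κ c ⟩
      ν * (ν * c) - κ * c           ≈⟨ +-cong (*-congˡ ν centre) (-‿cong κc) ⟨
      ν * (sum l + y) - ν * sum l   ≈⟨ solve 3 (λ ν s y → ν :* (s :+ y) :- ν :* s := ν :* y) ≋-refl ν (sum l) y ⟩
      ν * y                         ∎
      where
      κc : ν * sum l ≋ κ * c
      κc = begin
        ν * sum l                   ≈⟨ *-distribˡ-sum ν l ⟩
        sum (λ i → ν * l i)         ≈⟨ sum-cong-≋ leaf ⟨
        sum {k} (λ _ → c)           ≈⟨ sum-const k c ⟩
        κ * c                       ∎
    dp : (ν * ν - κ) * f (u zero) ≋ ν * y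
    dp = side (f (u zero)) (f ∘ u ∘ suc) (equations ∘ u ∘ suc) (equations (u zero))
    dq : (ν * ν - κ) * f (w zero) ≋ ν * y
    dq = side (f (w zero)) (f ∘ w ∘ suc) (equations ∘ w ∘ suc) (equations (w zero))
    y≋0 : y ≋ 0ℝ
    y≋0 = x*y≋0⇒y≋0 0≺ν (x*y≋0⇒y≋0 0≺e (begin
      e * (ν * y)
        ≈⟨ solve 3 (λ e t z → e :* z := (e :+ t) :* z :- t :* z) ≋-refl e (fromℕ 2) (ν * y) ⟩
      (e + fromℕ 2) * (ν * y) - fromℕ 2 * (ν * y)
        ≈⟨ +-congʳ (*-cong d≋ (equations v)) ⟨
      (ν * ν - κ) * (f (u zero) + f (w zero)) - fromℕ 2 * (ν * y)
        ≈⟨ +-congʳ (≋-trans (*-distribˡ-+ (ν * ν - κ) (f (u zero)) (f (w zero))) (+-cong dp dq)) ⟩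
      (ν * y + ν * y) - fromℕ 2 * (ν * y)
        ≈⟨ solve 1 (λ z → (z :+ z) :- con (ι 2) :* z := con 0ℚ) ≋-refl (ν * y) ⟩
      0ℝ ∎))
    centre≋0 : ∀ {c} → (ν * ν - κ) * c ≋ ν * y → c ≋ 0ℝ
    centre≋0 dc = x*y≋0⇒y≋0 0≺d (≋-trans dc (≋-trans (*-congˡ ν y≋0) (zeroʳ ν)))
    leaf≋0 : ∀ {c l} → c ≋ 0ℝ → c ≋ ν * l → l ≋ 0ℝ
    leaf≋0 c≋0 c≋νl = x*y≋0⇒y≋0 0≺ν (≋-trans (≋-sym c≋νl) c≋0)
    f≋0 : ∀ x → f x ≋ 0ℝ
    f≋0 (u zero)    = centre≋0 dp
    f≋0 (u (suc i)) = leaf≋0 (centre≋0 dp) (equations (u (suc i)))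
    f≋0 v           = y≋0
    f≋0 (w zero)    = centre≋0 dq
    f≋0 (w (suc i)) = leaf≋0 (centre≋0 dq) (equations (w (suc i)))

  λ₁ : ℝ
  λ₁ = sqrt (2 ℕ.+ k)

  -- With 1 on the leaves, the leaf equations force the eigenvalue itself on the centres, the
  -- equation at v then forces 2 there, and the centre equations become k + 2 = λ².
  λ₁-isEigenvalue : IsEigenvalue (T2Graph k) (adjacencyMatrix (T2Graph k)) λ₁
  λ₁-isEigenvalue = eigenvector⇒eigenvalue (T2Graph k) (adjacencyMatrix (T2Graph k)) (f≉0 , λ x → ≋-trans (adjacencyMatrix-row f x) (equations x))
    where
    open ≋-Reasoning
    open ℝ-Solver
    f : T2Vertex (suc k) → ℝ
    f (u zero)    = λ₁
    f (u (suc _)) = 1ℝ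
    f v           = fromℕ 2
    f (w zero)    = λ₁
    f (w (suc _)) = 1ℝ
    f≉0 : ¬ (∀ x → f x ≋ 0ℝ)
    -- The test is made at v, which exists for every k, while leaves are absent for k = 0; the value
    -- 2 there is not within 1 of 0.
    f≉0 f≋0 with ≋⇒≈ (f≋0 v) 1ℚ (ℚ.positive⁻¹ 1ℚ)
    ... | N , close = ℚ.<-irrefl refl (ℚ.<-≤-trans (ι-mono-< {1} {2} ℕ.≤-refl) (close N ℕ.≤-refl))
    centre : sum {k} (λ _ → 1ℝ) + fromℕ 2 ≋ λ₁ * λ₁
    centre = begin
      sum {k} (λ _ → 1ℝ) + fromℕ 2      ≈⟨ +-congʳ (sum-const k 1ℝ) ⟩
      fromℕ k * 1ℝ + fromℕ 2            ≈⟨ solve 2 (λ κ t → κ :* con 1ℚ :+ t := t :+ κ) ≋-refl (fromℕ k) (fromℕ 2) ⟩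
      fromℕ 2 + fromℕ k                 ≈⟨ fromℕ-+ 2 k ⟨
      fromℕ (2 ℕ.+ k)                   ≈⟨ sqrt²≋n (2 ℕ.+ k) ⟨
      λ₁ * λ₁                           ∎
    equations : ∀ x → neighbourSum f x ≋ λ₁ * f x
    equations (u zero)    = centre
    equations (u (suc _)) = ≋-sym (*-identityʳ λ₁)
    equations v           = solve 1 (λ m → m :+ m := m :* con (ι 2)) ≋-refl λ₁
    equations (w zero)    = centre
    equations (w (suc _)) = ≋-sym (*-identityʳ λ₁)

  -- An eigenvalue above λ₁ ≥ 0 is positive with square above k + 2. This serves both the maximality
  -- of `λ₁` and the bound on an arbitrary μ in `IsS₉`.
  eigenvalue≤λ₁ : ∀ ν → IsEigenvalue (T2Graph k) (adjacencyMatrix (T2Graph k)) ν → ¬ (λ₁ ≺ ν)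
  eigenvalue≤λ₁ ν eig λ₁≺ν = no-larger-eigenvalue
    (x≮0∧x≺y⇒0≺y (sqrt≮0 (2 ℕ.+ k)) λ₁≺ν)
    (≺-resp-≋ (sqrt²≋n (2 ℕ.+ k)) ≋-refl (x≺y⇒x²≺y² (sqrt≮0 (2 ℕ.+ k)) λ₁≺ν))
    eig

  λ₁-isLargestEigenvalue : IsLargestEigenvalue (T2Graph k) (adjacencyMatrix (T2Graph k)) λ₁
  λ₁-isLargestEigenvalue = λ₁-isEigenvalue , λ ν eig λ₁<ν → eigenvalue≤λ₁ ν eig (mk≺ λ₁<ν)

-- Independent sets

-- Search downwards: whenever the current bound fails `P`, it can be lowered by one, and at the
-- bottom `P 0` holds.
largest : ∀ {P : ℕ → Set} → Decidable P → P 0 → ∀ n → (∀ m → P m → m ℕ.≤ n) →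
  ∃[ a ] P a × (∀ m → P m → m ℕ.≤ a)
largest P? p0 zero    bound = 0 , p0 , bound
largest P? p0 (suc n) bound with P? (suc n)
... | yes p = suc n , p , bound
... | no ¬p = largest P? p0 n λ m pm → ℕ.≤-pred (ℕ.≤∧≢⇒< (bound m pm) λ { refl → ¬p pm })

module _ (G : Graph) where

  open Graph G

  isIndependent? : Decidable (IsIndependent G)
  isIndependent? S = Fin.all? λ i → Fin.all? λ j →
    (i ∈? S) →-dec ((j ∈? S) →-dec ¬? (adj? (vertex i) (vertex j)))

  -- The attained sizes form a decidable set, because there are finitely many subsets; the order
  -- bounds it and the empty set puts 0 in it.
  independenceNumber : ∃[ a ] IsIndependenceNumber G a
  independenceNumber with largest
    (λ a → anySubset? λ S → isIndependent? S ×-dec (∣ S ∣ ℕ.≟ a))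
    (⊥ , (λ _ _ i∈⊥ → contradiction i∈⊥ ∉⊥) , ∣⊥∣≡0 order)
    order (λ { _ (S , _ , refl) → ∣p∣≤n S })
  ... | a , attained , bound = a , attained , λ S ind → bound ∣ S ∣ (S , ind , refl)

∣p++q∣≡∣p∣+∣q∣ : ∀ {m n} (p : Subset m) (q : Subset n) → ∣ p ++ q ∣ ≡ ∣ p ∣ ℕ.+ ∣ q ∣
∣p++q∣≡∣p∣+∣q∣ []            q = refl
∣p++q∣≡∣p∣+∣q∣ (inside ∷ p)  q = cong suc (∣p++q∣≡∣p∣+∣q∣ p q)
∣p++q∣≡∣p∣+∣q∣ (outside ∷ p) q = ∣p++q∣≡∣p∣+∣q∣ p q

module _ (k : ℕ) where

  open Graph (T2Graph k) using (vertex; enumeration; order)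

  -- The entries follow the enumeration: u₁, the leaves uᵢ, v, w₁, the leaves wᵢ.
  nonCentres : Subset order
  nonCentres = (outside ∷ ⊤ {k}) ++ (inside ∷ outside ∷ ⊤ {k})

  ∣nonCentres∣ : ∣ nonCentres ∣ ≡ 1 ℕ.+ (k ℕ.+ k)
  ∣nonCentres∣ = trans (∣p++q∣≡∣p∣+∣q∣ (outside ∷ ⊤ {k}) (inside ∷ outside ∷ ⊤ {k}))
    (trans (cong₂ (λ m n → m ℕ.+ suc n) (∣⊤∣≡n k) (∣⊤∣≡n k)) (ℕ.+-suc k k))

  -- The two centres form a vertex cover: each of the four kinds of edge ends in one of them.
  nonCentres-independent : IsIndependent (T2Graph k) nonCentres
  nonCentres-independent i j i∈ j∈ = λ
    { (fwd e) → edge e (chosen i i∈) (chosen j j∈)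
    ; (bwd e) → edge e (chosen j j∈) (chosen i i∈) }
    where
    IsNonCentre : T2Vertex (suc k) → Set
    IsNonCentre x = x ≢ u zero × x ≢ w zero
    edge : ∀ {x y} → T2Edge x y → IsNonCentre x → ¬ IsNonCentre y
    edge u₁uᵢ (x≢u₁ , _) _          = x≢u₁ refl
    edge u₁v  (x≢u₁ , _) _          = x≢u₁ refl
    edge vw₁  _          (_ , y≢w₁) = y≢w₁ refl
    edge w₁wᵢ (_ , x≢w₁) _          = x≢w₁ refl
    outside≢inside : outside ≢ inside
    outside≢inside ()
    member : ∀ x → lookup nonCentres (Inverse.from enumeration x) ≡ inside → IsNonCentre x
    member x eq =
      (λ { refl → outside≢inside eq }) ,
      -- The centre u₁ has index 0, where the lookup computes; w₁ lies behind a block of variable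
      -- length, so its entry needs a lemma on concatenation.
      (λ { refl → outside≢inside (trans
        (sym (lookup-++ʳ (outside ∷ ⊤ {k}) (inside ∷ outside ∷ ⊤ {k}) (suc zero))) eq) })
    chosen : ∀ i → i ∈ nonCentres → IsNonCentre (vertex i)
    chosen i i∈ = member (vertex i) (subst (λ i → lookup nonCentres i ≡ inside)
      (sym (Inverse.strictlyInverseʳ enumeration i)) ([]=⇒lookup i∈))

  2b-1≤independenceNumber : ∀ {a} → IsIndependenceNumber (T2Graph k) a → 1 ℕ.+ (k ℕ.+ k) ℕ.≤ a
  2b-1≤independenceNumber (_ , bound) =
    subst (ℕ._≤ _) ∣nonCentres∣ (bound nonCentres nonCentres-independent)

-- The limit of s₉

fromℕ-suc-1 : ∀ n → fromℕ (suc n) - 1ℝ ≋ fromℕ n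
fromℕ-suc-1 n = ≋-trans (+-congʳ (fromℕ-+ 1 n))
  (solve 1 (λ n → (con 1ℚ :+ n) :- con 1ℚ := n) ≋-refl (fromℕ n))
  where open ℝ-Solver

opaque
  unfolding _+_ _*_ -_

  sqrt-isSqrt-pred : ∀ {n m} → n ≡ suc m → IsSqrt (fromℕ n Defs.- 1ℝ) (sqrt m)
  sqrt-isSqrt-pred {m = m} refl = (λ sqrt<0 → sqrt≮0 m (mk≺ sqrt<0)) ,
    ≋⇒≈ (≋-trans (sqrt²≋n m) (≋-sym (fromℕ-suc-1 m)))

  isSqrt-pred⇒ : ∀ {n m r} → n ≡ suc m → IsSqrt (fromℕ n Defs.- 1ℝ) r →
    ¬ (r ≺ 0ℝ) × r * r ≋ fromℕ m
  isSqrt-pred⇒ {m = m} refl (0≤r , r²≈) = (λ r≺0 → 0≤r (≺⇒< r≺0)) ,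
    ≋-trans {y = fromℕ (suc m) - 1ℝ} (mk≋ r²≈) (fromℕ-suc-1 m)

module _ (T : Tree) where

  open Graph using (order)

  s₉-intro : ∀ {G r μ a} → Tree.graph T ≡ G → IsSqrt (fromℕ (order G) Defs.- 1ℝ) r →
    IsLargestEigenvalue G (adjacencyMatrix G) μ →
    IsIndependenceNumber G a → ∃[ s ] IsS₉ T s
  s₉-intro {G} {r} {μ} {a} refl isSqrt isLargest isα =
    s , r , μ , a , isSqrt , isLargest , isα , ≋⇒≈ (≋-refl {s})
    where
    s : ℝ
    s = r Defs.- fromℕ (order G) Defs.+ 1ℝ Defs.- μ Defs.+ fromℕ a

  opaque
    unfolding _+_ -_

    s₉-elim : ∀ {G s} → Tree.graph T ≡ G → IsS₉ T s → ∃[ r ] ∃[ μ ] ∃[ a ]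
      IsSqrt (fromℕ (order G) Defs.- 1ℝ) r ×
      IsLargestEigenvalue G (adjacencyMatrix G) μ ×
      IsIndependenceNumber G a ×
      s ≋ r - fromℕ (order G) + 1ℝ - μ + fromℕ a
    s₉-elim refl (r , μ , a , isSqrt , isLargest , isα , s≈) =
      r , μ , a , isSqrt , isLargest , isα , mk≋ s≈

fromℕ-≮ : ∀ {m n} → m ℕ.≤ n → ¬ (fromℕ n ≺ fromℕ m)
fromℕ-≮ m≤n n≺m = ℚ.<-irrefl refl (ℚ.≤-<-trans (ι-mono-≤ m≤n) (fromℚ-cancel-≺ n≺m))

≺fromℕ : ∀ x → ∃[ K ] x ≺ fromℕ K
≺fromℕ x = from (bounded x)
  where
  above : ∀ {B K N} → (∀ n → N ℕ.≤ n → ℚ.∣ seq x n ∣ ℚ.≤ B) → B ℚ.+ 1ℚ ℚ.≤ ι K → x ≺ fromℕ K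
  above {N = N} x≤B B+1≤K = mk≺ (1ℚ , ℚ.positive⁻¹ 1ℚ , N , λ n N≤n →
    ℚ.≤-trans (ℚ.+-monoˡ-≤ 1ℚ (ℚ.≤-trans (p≤∣p∣ (seq x n)) (x≤B n N≤n))) B+1≤K)
  from : (∃[ B ] 0ℚ ℚ.< B × Eventually λ n → ℚ.∣ seq x n ∣ ℚ.≤ B) → ∃[ K ] x ≺ fromℕ K
  from (B , _ , N , x≤B) = proj₁ (archimedean (B ℚ.+ 1ℚ)) ,
    above {B} {proj₁ (archimedean (B ℚ.+ 1ℚ))} {N} x≤B (proj₂ (archimedean (B ℚ.+ 1ℚ)))

-- Since 4mL ≤ m² + 4L², we have 2(m + L)² ≤ 3m² + 6L² = 3(k + 2) + 6L², which is at most
-- 2r² = 4(k + 1) once k ≥ 6L² + 2.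
√+L≤√ : ∀ k L {r m} → 2 ℕ.+ 6 ℕ.* (L ℕ.* L) ℕ.≤ k → ¬ (r ≺ 0ℝ) →
  r * r ≋ fromℕ (2 ℕ.+ (k ℕ.+ k)) → m * m ≋ fromℕ (2 ℕ.+ k) → ¬ (r ≺ m + fromℕ L)
√+L≤√ k L {r} {m} large r≮0 r² m² r≺m+L = fromℕ-≮ large k≺N
  where
  open ≋-Reasoning
  open ℝ-Solver
  ℓ κ : ℝ
  ℓ = fromℕ L
  κ = fromℕ k
  -- The weight 2 and the square of m - 2ℓ are chosen so that the mixed terms 4mℓ cancel. Were r < m
  -- + L, the left side would be positive and k would lie below 2 + 6L².
  difference : ((m + ℓ) * (m + ℓ) - r * r) * fromℕ 2 + (m - fromℕ 2 * ℓ) * (m - fromℕ 2 * ℓ) ≋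
    fromℕ (2 ℕ.+ 6 ℕ.* (L ℕ.* L)) - κ
  difference = begin
    ((m + ℓ) * (m + ℓ) - r * r) * fromℕ 2 + (m - fromℕ 2 * ℓ) * (m - fromℕ 2 * ℓ)
      ≈⟨ solve 3 (λ m ℓ r →
           ((m :+ ℓ) :* (m :+ ℓ) :- r :* r) :* con (ι 2) :+ (m :- con (ι 2) :* ℓ) :* (m :- con (ι 2) :* ℓ) :=
           con (ι 3) :* (m :* m) :+ con (ι 6) :* (ℓ :* ℓ) :- con (ι 2) :* (r :* r)) ≋-refl m ℓ r ⟩
    fromℕ 3 * (m * m) + fromℕ 6 * (ℓ * ℓ) - fromℕ 2 * (r * r)
      ≈⟨ +-cong (+-congʳ (*-congˡ (fromℕ 3) (≋-trans m² (fromℕ-+ 2 k))))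
           (-‿cong (*-congˡ (fromℕ 2) (≋-trans r² (≋-trans (fromℕ-+ 2 (k ℕ.+ k)) (+-congˡ (fromℕ-+ k k)))))) ⟩
    fromℕ 3 * (fromℕ 2 + κ) + fromℕ 6 * (ℓ * ℓ) - fromℕ 2 * (fromℕ 2 + (κ + κ))
      ≈⟨ solve 2 (λ κ ℓ² →
           con (ι 3) :* (con (ι 2) :+ κ) :+ con (ι 6) :* ℓ² :- con (ι 2) :* (con (ι 2) :+ (κ :+ κ)) :=
           (con (ι 2) :+ con (ι 6) :* ℓ²) :- κ) ≋-refl κ (ℓ * ℓ) ⟩
    (fromℕ 2 + fromℕ 6 * (ℓ * ℓ)) - κ
      ≈⟨ +-congʳ (≋-trans (fromℕ-+ 2 (6 ℕ.* (L ℕ.* L)))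
           (+-congˡ (≋-trans (fromℕ-* 6 (L ℕ.* L)) (*-congˡ (fromℕ 6) (fromℕ-* L L))))) ⟨
    fromℕ (2 ℕ.+ 6 ℕ.* (L ℕ.* L)) - κ ∎
  0≺2 : 0ℝ ≺ fromℕ 2
  0≺2 = fromℚ-mono-≺ (ι-mono-< {0} {2} (ℕ.s≤s ℕ.z≤n))
  0≺gap : 0ℝ ≺ ((m + ℓ) * (m + ℓ) - r * r) * fromℕ 2
  0≺gap = 0≺x*y (x≺y⇒0≺y-x (x≺y⇒x²≺y² r≮0 r≺m+L)) 0≺2
  k≺N : fromℕ k ≺ fromℕ (2 ℕ.+ 6 ℕ.* (L ℕ.* L))
  k≺N = 0≺y-x⇒x≺y (≺-resp-≋ ≋-refl difference (0≺x+y 0≺gap (x*x≮0 (m - fromℕ 2 * ℓ))))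

order-T2 : ∀ k → Graph.order (T2Graph k) ≡ 3 ℕ.+ (k ℕ.+ k)
order-T2 k = cong suc (trans (ℕ.+-suc k (suc k)) (cong suc (ℕ.+-suc k k)))

s₉-exists : ∀ b .{{_ : NonZero b}} → ∃[ s ] IsS₉ (T2 b) s
s₉-exists (suc k) {{nz}} = s₉-intro (T2 (suc k) {{nz}}) {T2Graph k}
  {sqrt (2 ℕ.+ (k ℕ.+ k))} {λ₁ {k}} {proj₁ (independenceNumber (T2Graph k))} refl
  (sqrt-isSqrt-pred (order-T2 k)) (λ₁-isLargestEigenvalue {k}) (proj₂ (independenceNumber (T2Graph k)))

-- Since -n + 1 + α ≥ -(2k + 3) + 1 + (2k + 1) = -1, the margin between the two roots is taken to be
-- K + 1, one more than the target. Then s - M is the positive number K - M plus three terms that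
-- are not negative.
s₉-estimate : ∀ k K a {M s r μ m} → 2 ℕ.+ 6 ℕ.* (suc K ℕ.* suc K) ℕ.≤ k → M ≺ fromℕ K →
  ¬ (r ≺ 0ℝ) → r * r ≋ fromℕ (2 ℕ.+ (k ℕ.+ k)) →
  m * m ≋ fromℕ (2 ℕ.+ k) → ¬ (m ≺ μ) →
  1 ℕ.+ (k ℕ.+ k) ℕ.≤ a → s ≋ r - fromℕ (3 ℕ.+ (k ℕ.+ k)) + 1ℝ - μ + fromℕ a → M ≺ s
s₉-estimate k K a {M} {s} {r} {μ} {m} large M≺K r≮0 r² m² m≮μ a≥ s≋ =
  0≺y-x⇒x≺y (≺-resp-≋ ≋-refl (≋-sym difference)
    (0≺x+y (0≺x+y (0≺x+y (x≺y⇒0≺y-x M≺K)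
      (x≮y⇒x-y≮0 (√+L≤√ k (suc K) large r≮0 r² m²)))
      (x≮y⇒x-y≮0 m≮μ))
      (x≮y⇒x-y≮0 (fromℕ-≮ a≥))))
  where
  open ≋-Reasoning
  open ℝ-Solver
  κκ : ℝ
  κκ = fromℕ (k ℕ.+ k)
  difference : s - M ≋ (((fromℕ K - M) + (r - (m + fromℕ (suc K)))) + (m - μ)) +
    (fromℕ a - fromℕ (1 ℕ.+ (k ℕ.+ k)))
  difference = begin
    s - M
      ≈⟨ +-congʳ s≋ ⟩
    r - fromℕ (3 ℕ.+ (k ℕ.+ k)) + 1ℝ - μ + fromℕ a - M
      ≈⟨ +-congʳ (+-congʳ (+-congʳ (+-congʳ (+-congˡ (-‿cong (fromℕ-+ 3 (k ℕ.+ k))))))) ⟩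
    r - (fromℕ 3 + κκ) + 1ℝ - μ + fromℕ a - M
      ≈⟨ solve 7 (λ r d μ a M K m →
           r :- (con (ι 3) :+ d) :+ con 1ℚ :- μ :+ a :- M :=
           (((K :- M) :+ (r :- (m :+ (con 1ℚ :+ K)))) :+ (m :- μ)) :+ (a :- (con 1ℚ :+ d)))
           ≋-refl r κκ μ (fromℕ a) M (fromℕ K) m ⟩
    (((fromℕ K - M) + (r - (m + (1ℝ + fromℕ K)))) + (m - μ)) + (fromℕ a - (1ℝ + κκ))
      ≈⟨ +-cong (+-congʳ (+-congˡ (+-congˡ (-‿cong (+-congˡ (fromℕ-+ 1 K))))))
           (+-congˡ (-‿cong (fromℕ-+ 1 (k ℕ.+ k)))) ⟨
    (((fromℕ K - M) + (r - (m + fromℕ (suc K)))) + (m - μ)) + (fromℕ a - fromℕ (1 ℕ.+ (k ℕ.+ k))) ∎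

-- The witnesses in `IsS₉` are arbitrary: r enters through r ≥ 0 and r² = n - 1, μ through μ ≤ λ₁,
-- and a through its lower bound.
s₉-lowerBound : ∀ k .{{nz : NonZero (suc k)}} {M s} K → 2 ℕ.+ 6 ℕ.* (suc K ℕ.* suc K) ℕ.≤ k →
  M ≺ fromℕ K → IsS₉ (T2 (suc k) {{nz}}) s → M ≺ s
s₉-lowerBound k {{nz}} {M} {s} K large M≺K isS₉ =
  from (s₉-elim (T2 (suc k) {{nz}}) {T2Graph k} {s} refl isS₉)
  where
  from : (∃[ r ] ∃[ μ ] ∃[ a ]
    IsSqrt (fromℕ (Graph.order (T2Graph k)) Defs.- 1ℝ) r ×
    IsLargestEigenvalue (T2Graph k) (adjacencyMatrix (T2Graph k)) μ ×
    IsIndependenceNumber (T2Graph k) a ×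
    s ≋ r - fromℕ (Graph.order (T2Graph k)) + 1ℝ - μ + fromℕ a) → M ≺ s
  from (r , μ , a , isSqrt , (isEigenvalue , _) , isα , s≋) =
    s₉-estimate k K a {M} {s} {r} {μ} {λ₁ {k}} large M≺K
      (proj₁ sqrtFacts) (proj₂ sqrtFacts) (sqrt²≋n (2 ℕ.+ k)) (eigenvalue≤λ₁ {k} μ isEigenvalue)
      (2b-1≤independenceNumber k isα)
      (subst (λ n → s ≋ r - fromℕ n + 1ℝ - μ + fromℕ a) (order-T2 k) s≋)
    where
    sqrtFacts : ¬ (r ≺ 0ℝ) × r * r ≋ fromℕ (2 ℕ.+ (k ℕ.+ k))
    sqrtFacts = isSqrt-pred⇒ {Graph.order (T2Graph k)} {r = r} (order-T2 k) isSqrt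

s₉-tendsTo∞ : (s : (b : ℕ) .{{_ : NonZero b}} → ℝ) →
  (∀ b .{{_ : NonZero b}} → IsS₉ (T2 b) (s b)) → TendsTo∞ s
s₉-tendsTo∞ s isS₉ M = from (≺fromℕ M)
  where
  from : ∃[ K ] M ≺ fromℕ K → ∃[ B ] ∀ b .{{_ : NonZero b}} → B ℕ.≤ b → M < s b
  -- The threshold is 6L² + 3 with L = K + 1; as b = k + 1, it leaves k ≥ 6L² + 2.
  from (K , M≺K) = 3 ℕ.+ 6 ℕ.* (suc K ℕ.* suc K) , beyond
    where
    beyond : ∀ b .{{_ : NonZero b}} → 3 ℕ.+ 6 ℕ.* (suc K ℕ.* suc K) ℕ.≤ b → M < s b
    beyond (suc k) {{nz}} (ℕ.s≤s large) = ≺⇒<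
      (s₉-lowerBound k {{nz}} {M} {s (suc k) {{nz}}} K large M≺K (isS₉ (suc k) {{nz}}))

theorem3 : (∀ b .{{_ : NonZero b}} → ∃[ s ] IsS₉ (T2 b) s)
    × ((s : (b : ℕ) .{{_ : NonZero b}} → ℝ) →
    (∀ b .{{_ : NonZero b}} → IsS₉ (T2 b) (s b)) →
    TendsTo∞ s)
theorem3 = s₉-exists , s₉-tendsTo∞
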